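{- Let $k$ be a prime power, let $0 \le h \le 4$ be an integer, and let $n=k^2+k+1-h$. Then there exists a $C_4$-free subgraph of $K_{n,n}$ whose number of edges equals the right-hand side below for the given $h$, and consequently $$ z(k^2+k+1-h) \geq \begin{cases} k^3+2k^2+2k+1 & \text{for } h=0,\\ k^3+2k^2 & \text{for } h=1,\\ k^3+2k^2-2k & \text{for } h=2,\\ k^3+2k^2-4k+1 & \text{for } h=3,\\ k^3+2k^2-6k+2 & \text{for } h=4. \end{cases} $$
   Context: For a nonnegative integer $n$, $z(n)$ denotes the Zarankiewicz number $z(n,n;2,2)$: the maximum number of edges in a subgraph of the complete bipartite graph $K_{n,n}$ that does not contain $K_{2,2}=C_4$ (the 4-cycle) as a subgraph (not necessarily induced). Equivalently, $z(n)$ is the maximum number of 1's in an $n\times n$ 0-1 matrix with no $2\times 2$ submatrix (rows and columns not necessarily consecutive) consisting entirely of 1's. A prime power is a number $p^a$ with $p$ prime and $a\ge 1$. -}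

module Defs where

open import Data.Bool.Base using (Bool; true; false)
open import Data.Empty using (⊥)
open import Data.Fin.Base using (Fin)
open import Data.Fin.Patterns using (0F; 1F; 2F; 3F; 4F)
import Data.Fin.Properties as Fin
open import Data.Fin.Subset using (Subset; _∈_; ∣_∣) renaming (⊥ to ∅)
open import Data.Fin.Subset.Properties using (_∈?_; ∉⊥)
open import Data.Integer.Base using (ℤ; +_)
open import Data.List.Base using (List; []; _∷_; [_]; cartesianProductWith; filter)
open import Data.List.Extrema.Nat using (argmax; argmax-all; f[xs]≤f[argmax])
import Data.List.Membership.Propositional as List
open import Data.List.Membership.Propositional.Properties
  using (∈-cartesianProductWith⁺; ∈-filter⁺)
import Data.List.Relation.Unary.All as All
open import Data.List.Relation.Unary.All.Properties using (all-filter)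
open import Data.List.Relation.Unary.Any using (here; there)
open import Data.Nat.Base as ℕ using (ℕ; zero; suc; _≤_)
open import Data.Nat.Primality using (Prime)
open import Data.Product.Base using (∃; ∃-syntax; _×_; _,_)
open import Data.Sum.Base using (_⊎_; inj₁; inj₂; [_,_]′)
import Data.Sum.Properties as Sum
open import Data.Vec.Base using (Vec; []; _∷_; lookup; map; replicate; sum)
open import Data.Vec.Properties using (lookup-replicate)
open import Level using (Level)
open import Relation.Binary.Definitions using (DecidableEquality)
open import Relation.Binary.PropositionalEquality using (_≡_; _≢_; refl; subst)
open import Relation.Nullary using (¬_; Dec)
open import Relation.Nullary.Decidable using (map′; _⊎-dec_; _×-dec_; ¬?; no)

private
  variable
    a p : Level
    A : Set a
    m n : ℕ

IsPrimePower : ℕ → Set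
IsPrimePower k = ∃[ p ] ∃[ e ] Prime p × 1 ≤ e × k ≡ p ℕ.^ e

Vertex : ℕ → Set
Vertex n = Fin n ⊎ Fin n

-- A subgraph of K_{n,n}: row i is the set of right-hand neighbours of the
-- left-hand vertex i. Only spanning subgraphs are represented; isolated
-- vertices affect neither the number of edges nor the 4-cycles.
Subgraph : ℕ → Set
Subgraph n = Vec (Subset n) n

edges : Subgraph n → ℕ
edges G = sum (map ∣_∣ G)

Adj : Subgraph n → Vertex n → Vertex n → Set
Adj G (inj₁ i) (inj₂ j) = j ∈ lookup G i
Adj G (inj₂ j) (inj₁ i) = j ∈ lookup G i
Adj G (inj₁ _) (inj₁ _) = ⊥
Adj G (inj₂ _) (inj₂ _) = ⊥

-- Consecutive vertices of the cycle are distinct because Adj is irreflexive.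
HasC₄ : Subgraph n → Set
HasC₄ {n} G = ∃[ u ] ∃[ v ] ∃[ w ] ∃[ x ]
  u ≢ w × v ≢ x × Adj {n} G u v × Adj G v w × Adj G w x × Adj G x u

C₄-free : Subgraph n → Set
C₄-free G = ¬ HasC₄ G

anyVertex? : {P : Vertex n → Set p} → (∀ v → Dec (P v)) → Dec (∃ P)
anyVertex? P? = map′
  [ (λ (i , q) → inj₁ i , q) , (λ (j , q) → inj₂ j , q) ]′
  (λ { (inj₁ i , q) → inj₁ (i , q) ; (inj₂ j , q) → inj₂ (j , q) })
  (Fin.any? (λ i → P? (inj₁ i)) ⊎-dec Fin.any? (λ j → P? (inj₂ j)))

_≟ᵛ_ : DecidableEquality (Vertex n)
_≟ᵛ_ = Sum.≡-dec Fin._≟_ Fin._≟_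

adj? : (G : Subgraph n) (u v : Vertex n) → Dec (Adj G u v)
adj? G (inj₁ i) (inj₂ j) = j ∈? lookup G i
adj? G (inj₂ j) (inj₁ i) = j ∈? lookup G i
adj? G (inj₁ _) (inj₁ _) = no λ ()
adj? G (inj₂ _) (inj₂ _) = no λ ()

C₄-free? : (G : Subgraph n) → Dec (C₄-free G)
C₄-free? G = ¬? (anyVertex? λ u → anyVertex? λ v → anyVertex? λ w → anyVertex? λ x →
  ¬? (u ≟ᵛ w) ×-dec ¬? (v ≟ᵛ x) ×-dec
  adj? G u v ×-dec adj? G v w ×-dec adj? G w x ×-dec adj? G x u)

allVecs : List A → (m : ℕ) → List (Vec A m)
allVecs xs zero    = [ [] ]
allVecs xs (suc m) = cartesianProductWith _∷_ xs (allVecs xs m)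

allSubgraphs : (n : ℕ) → List (Subgraph n)
allSubgraphs n = allVecs (allVecs (true ∷ false ∷ []) n) n

edgeless : Subgraph n
edgeless {n} = replicate n ∅

-- A C₄-free subgraph with the most edges; edgeless is only the value that
-- argmax returns on an empty list, and is itself C₄-free.
extremal : (n : ℕ) → Subgraph n
extremal n = argmax edges edgeless (filter C₄-free? (allSubgraphs n))

-- The Zarankiewicz number z(n,n;2,2).
z : ℕ → ℕ
z n = edges (extremal n)

∈-allVecs : {xs : List A} → (∀ x → x List.∈ xs) → (v : Vec A m) → v List.∈ allVecs xs m
∈-allVecs all∈ []      = here refl
∈-allVecs all∈ (x ∷ v) = ∈-cartesianProductWith⁺ _∷_ (all∈ x) (∈-allVecs all∈ v)

∈-allSubgraphs : (G : Subgraph n) → G List.∈ allSubgraphs n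
∈-allSubgraphs = ∈-allVecs (∈-allVecs λ { true → here refl ; false → there (here refl) })

edgeless-C₄-free : C₄-free (edgeless {n})
edgeless-C₄-free {n} (inj₁ i , inj₂ j , _ , _ , _ , _ , e , _) =
  ∉⊥ (subst (j ∈_) (lookup-replicate i ∅) e)
edgeless-C₄-free {n} (inj₂ j , inj₁ i , _ , _ , _ , _ , e , _) =
  ∉⊥ (subst (j ∈_) (lookup-replicate i ∅) e)

extremal-C₄-free : (n : ℕ) → C₄-free (extremal n)
extremal-C₄-free n = argmax-all edges edgeless-C₄-free (all-filter C₄-free? (allSubgraphs n))

edges≤z : (G : Subgraph n) → C₄-free G → edges G ≤ z n
edges≤z {n} G free = All.lookup
  (f[xs]≤f[argmax] edgeless (filter C₄-free? (allSubgraphs n)))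
  (∈-filter⁺ C₄-free? (∈-allSubgraphs G) free)

bound : ℕ → Fin 5 → ℤ
bound k = λ where
    0F → x ^ 3 + + 2 * x ^ 2 + + 2 * x + + 1
    1F → x ^ 3 + + 2 * x ^ 2
    2F → x ^ 3 + + 2 * x ^ 2 - + 2 * x
    3F → x ^ 3 + + 2 * x ^ 2 - + 4 * x + + 1
    4F → x ^ 3 + + 2 * x ^ 2 - + 6 * x + + 2
  where
  open import Data.Integer.Base using (_+_; _-_; _*_; _^_)
  x = + k

{-# OPTIONS --safe #-}
module Submission where

-- Every field of order q = p ^ e is a quotient of R = 𝔽ₚ[X]/(X^(q-1) - 1), and x^q = x
-- holds throughout R.  So each nonzero a in R satisfies a·a·a^(q-2) = a, and multiplying
-- the nonzero ε = ∏ (X^(p^i) - X), 1 ≤ i < e, successively by every element of R that does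
-- not annihilate it produces a nonzero ε for which R / Ann ε is a field.  There the image
-- α of X has e distinct conjugates α^(p^i), hence 1, α, …, α^(e-1) are independent over
-- 𝔽ₚ and the field has at least q elements; as roots of X^q - X they are at most q.
--
-- From the projective plane over this field delete h points and h lines with as many
-- incidences among them as possible: initial segments of two lists of length four with
-- 0, 1, 3, 6, 9 incidences.

open import Defs
open import Algebra.Bundles using (AbelianGroup; CommutativeRing)
open import Algebra.Structures using (IsCommutativeRing)
open import Data.Bool.Base using (Bool; true; false)
open import Data.Fin.Base
  using (Fin; zero; suc; toℕ; fromℕ; fromℕ<; inject₁; finToFun; funToFin; combine)
open import Data.Fin.Patterns using (0F; 1F; 2F; 3F; 4F)
open import Data.Fin.Properties
  using (toℕ<n; toℕ-fromℕ; toℕ-fromℕ<; toℕ-inject₁; toℕ-injective; toℕ≤pred[n]; suc-injective;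
         any?; all?; funToFin-finToFin)
open import Data.Fin.Subset using (∣_∣) renaming (_∈_ to _∈ˢ_)
open import Data.List.Base
  using (List; []; _∷_; [_]; _++_; map; length; take; replicate; concat; upTo; allFin;
         cartesianProductWith)
open import Data.List.Membership.Propositional using (_∈_)
open import Data.List.Membership.Propositional.Properties
import Data.List.Properties as List
import Data.List.Relation.Binary.Permutation.Setoid.Properties as Permutation
open import Data.List.Relation.Binary.Permutation.Propositional
  using (_↭_; ↭-refl; ↭-trans; ↭-prep; ↭⇒↭ₛ)
open import Data.List.Relation.Binary.Permutation.Propositional.Properties
  using (shift; map⁺; ↭-length; ∈-resp-↭)
open import Data.List.Relation.Unary.All as All using (All; []; _∷_)
import Data.List.Relation.Unary.All.Properties as All
open import Data.List.Relation.Unary.AllPairs using ([]; _∷_)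
open import Data.List.Relation.Unary.Any as Any using (Any; here; there)
open import Data.List.Relation.Unary.Unique.Propositional using (Unique)
import Data.List.Relation.Unary.Unique.Propositional.Properties as Unique
open import Data.Nat.Base as ℕ using (ℕ; zero; suc; _≤_; _<_; _∸_; z≤n; s≤s; NonZero; _!)
open import Data.Nat.Combinatorics using (_C_; nCk≡n!/k![n-k]!; k![n∸k]!∣n!; nCn≡1)
open import Data.Nat.Coprimality using (prime⇒coprime; coprime-Bézout)
open import Data.Nat.Divisibility using (_∣_; _∤_; divides; m∣m*n; >⇒∤; ∣1⇒≡1)
open import Data.Nat.DivMod
open import Data.Nat.GCD using (module Bézout)
open import Data.Nat.Primality using (Prime; euclidsLemma; prime⇒nonZero; prime⇒nonTrivial)
import Data.Nat.Properties as ℕₚ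
open import Data.Product.Base using (∃; ∃₂; _,_; proj₁; proj₂)
open import Data.Sum.Base as Sum using (_⊎_; inj₁; inj₂; [_,_]′)
open import Data.Vec.Base as Vec using (Vec; []; _∷_; toList; fromList; lookup)
open import Data.Vec.Properties using (lookup-map; []=⇒lookup; toList∘fromList)
open import Data.Vec.Relation.Unary.AllPairs.Core using ([]; _∷_)
import Data.Vec.Relation.Unary.All.Properties as Vec
import Data.Vec.Relation.Unary.Unique.Propositional as Vec
import Data.Vec.Relation.Unary.Unique.Propositional.Properties as Vec
open import Function.Base using (_∘_; id)
open import Level using (0ℓ)
open import Relation.Binary.Definitions using (Decidable; tri<; tri≈; tri>)
open import Relation.Binary.PropositionalEquality as ≡ using (_≡_; _≢_; ≢-sym)
open import Relation.Nullary using (¬_; Dec; yes; no; does; contradiction)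
open import Relation.Nullary.Decidable using (map′; dec-true; dec-false)

-- Commutative rings of prime characteristic

prime∤! : ∀ {p} → Prime p → ∀ m → m < p → p ∤ m !
prime∤! pr zero    m<p p∣1 = contradiction (∣1⇒≡1 p∣1) (ℕ.nonTrivial⇒≢1 {{prime⇒nonTrivial pr}})
prime∤! pr (suc m) m<p p∣m! =
  [ >⇒∤ m<p , prime∤! pr m (ℕₚ.<-trans (ℕₚ.n<1+n m) m<p) ]′ (euclidsLemma (suc m) (m !) pr p∣m!)

prime∣binomial : ∀ {p} → Prime p → ∀ k → 0 < k → k < p → p ∣ p C k
prime∣binomial {p} pr k 0<k k<p with euclidsLemma (p C k) (k ! ℕ.* (p ∸ k) !) pr (≡.subst (p ∣_) (≡.sym eq) p∣p!)
  where
  instance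
    _ = k ℕₚ.!* (p ∸ k) !≢0
    _ = prime⇒nonZero pr
  eq : (p C k) ℕ.* (k ! ℕ.* (p ∸ k) !) ≡ p !
  eq = ≡.trans (≡.cong (ℕ._* (k ! ℕ.* (p ∸ k) !)) (nCk≡n!/k![n-k]! (ℕₚ.<⇒≤ k<p)))
               (m/n*n≡m (k![n∸k]!∣n! (ℕₚ.<⇒≤ k<p)))
  p∣p! : p ∣ p !
  p∣p! = ≡.subst (λ m → m ∣ m !) (ℕₚ.suc-pred p) (m∣m*n (ℕ.pred p !))
... | inj₁ p∣C = p∣C
... | inj₂ p∣k![p-k]! = contradiction p∣k![p-k]! (λ d → [ prime∤! pr k k<p , prime∤! pr (p ∸ k) p-k<p ]′ (euclidsLemma (k !) ((p ∸ k) !) pr d))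
  where
  p-k<p : p ∸ k < p
  p-k<p = ℕₚ.∸-monoʳ-< 0<k (ℕₚ.<⇒≤ k<p)

module RingProperties (R : CommutativeRing 0ℓ 0ℓ) where
  open CommutativeRing R renaming (zero to *-zero)
  open import Algebra.Properties.CommutativeSemiring.Exp commutativeSemiring public
  open import Algebra.Properties.Semiring.Mult semiring public
  open import Algebra.Properties.Ring ring public
  open import Algebra.Properties.Semiring.Sum semiring
    using (sum; sum-init-last; sum-replicate-zero; sum-cong-≋)
  open import Algebra.Properties.CommutativeSemiring.Binomial commutativeSemiring as Binomial
    using (binomialTerm)
  open import Relation.Binary.Reasoning.Setoid setoid

  module _ {p} (pr : Prime p) (p×1≈0 : p × 1# ≈ 0#) where

    ∣⇒×≈0 : ∀ {m} → p ∣ m → ∀ x → m × x ≈ 0#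
    ∣⇒×≈0 (divides q ≡.refl) x = begin
      (q ℕ.* p) × x       ≈⟨ ×-assocˡ x q p ⟨
      q × (p × x)         ≈⟨ ×-congʳ q (×-congʳ p (*-identityˡ x)) ⟨
      q × (p × (1# * x))  ≈⟨ ×-congʳ q (×-assoc-* p 1# x) ⟨
      q × ((p × 1#) * x)  ≈⟨ ×-congʳ q (trans (*-congʳ p×1≈0) (zeroˡ x)) ⟩
      q × 0#              ≈⟨ ×-congʳ q (zeroˡ 0#) ⟨
      q × (0# * 0#)       ≈⟨ ×-comm-* q 0# 0# ⟨
      0# * (q × 0#)       ≈⟨ zeroˡ _ ⟩
      0#                  ∎

    frobenius-+ : ∀ x y → (x + y) ^ p ≈ x ^ p + y ^ p
    frobenius-+ x y = go p ≡.refl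
      where
      go : ∀ m → p ≡ m → (x + y) ^ m ≈ x ^ m + y ^ m
      go zero          ≡.refl = contradiction pr λ ()
      go m@(suc m-1) ≡.refl = begin
        (x + y) ^ m                                                  ≈⟨ Binomial.theorem m x y ⟩
        term zero + sum (λ i → term (suc i))
          ≈⟨ +-congˡ (sum-init-last (λ i → term (suc i))) ⟩
        term zero + (sum (λ i → term (suc (inject₁ i))) + term (suc (fromℕ m-1)))
          ≈⟨ +-cong first (+-cong middle last) ⟩
        y ^ m + (0# + x ^ m)                                         ≈⟨ +-congˡ (+-identityˡ _) ⟩
        y ^ m + x ^ m                                                ≈⟨ +-comm _ _ ⟩
        x ^ m + y ^ m                                                ∎
        where
        term = binomialTerm x y m
        first : term zero ≈ y ^ m
        first = trans (+-identityʳ _) (*-identityˡ _)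
        last : term (suc (fromℕ m-1)) ≈ x ^ m
        last rewrite toℕ-fromℕ m-1 | nCn≡1 m | ℕₚ.n∸n≡0 m-1 = trans (+-identityʳ _) (*-identityʳ _)
        middle : sum (λ i → term (suc (inject₁ i))) ≈ 0#
        middle = trans (sum-cong-≋ λ i →
            ∣⇒×≈0 (prime∣binomial pr (suc (toℕ (inject₁ i))) (s≤s z≤n)
                     (≡.subst (λ j → suc j < m) (≡.sym (toℕ-inject₁ i)) (s≤s (toℕ<n i)))) _)
          (sum-replicate-zero m-1)

    frobenius^-+ : ∀ e x y → (x + y) ^ (p ℕ.^ e) ≈ x ^ (p ℕ.^ e) + y ^ (p ℕ.^ e)
    frobenius^-+ zero    x y = trans (*-identityʳ _) (sym (+-cong (*-identityʳ _) (*-identityʳ _)))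
    frobenius^-+ (suc e) x y = begin
      (x + y) ^ (p ℕ.* p ℕ.^ e)                      ≈⟨ ^-assocʳ (x + y) p (p ℕ.^ e) ⟨
      ((x + y) ^ p) ^ (p ℕ.^ e)                      ≈⟨ ^-congˡ (p ℕ.^ e) (frobenius-+ x y) ⟩
      (x ^ p + y ^ p) ^ (p ℕ.^ e)                    ≈⟨ frobenius^-+ e (x ^ p) (y ^ p) ⟩
      (x ^ p) ^ (p ℕ.^ e) + (y ^ p) ^ (p ℕ.^ e)      ≈⟨ +-cong (^-assocʳ x p _) (^-assocʳ y p _) ⟩
      x ^ (p ℕ.* p ℕ.^ e) + y ^ (p ℕ.* p ℕ.^ e)      ∎

    0^[p^j]≈0 : ∀ j → 0# ^ (p ℕ.^ j) ≈ 0#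
    0^[p^j]≈0 j with p ℕ.^ j in eq
    ... | zero  = contradiction (ℕₚ.m^n≡0⇒m≡0 p j eq) (ℕ.≢-nonZero⁻¹ p {{prime⇒nonZero pr}})
    ... | suc _ = zeroˡ _

funToFin-cong : ∀ {m n} {f g : Fin m → Fin n} → (∀ i → f i ≡ g i) → funToFin f ≡ funToFin g
funToFin-cong {zero}  f≗g = ≡.refl
funToFin-cong {suc m} f≗g = ≡.cong₂ combine (f≗g zero) (funToFin-cong (f≗g ∘ suc))

finToFun-injective : ∀ {m n} {i j : Fin (m ℕ.^ n)} →
                     (∀ l → finToFun {m} {n} i l ≡ finToFun {m} {n} j l) → i ≡ j
finToFun-injective {m} {n} {i} {j} eq = begin
  i                             ≡⟨ funToFin-finToFin {n} {m} i ⟨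
  funToFin (finToFun {m} {n} i) ≡⟨ funToFin-cong eq ⟩
  funToFin (finToFun {m} {n} j) ≡⟨ funToFin-finToFin {n} {m} j ⟩
  j                             ∎
  where open ≡.≡-Reasoning

^-*-exchange : ∀ p {i j e} → i ≤ j → i ≤ e → p ℕ.^ (j ∸ i) ℕ.* p ℕ.^ e ≡ p ℕ.^ j ℕ.* p ℕ.^ (e ∸ i)
^-*-exchange p {i} {j} {e} i≤j i≤e = begin
  p ℕ.^ (j ∸ i) ℕ.* p ℕ.^ e         ≡⟨ ℕₚ.^-distribˡ-+-* p (j ∸ i) e ⟨
  p ℕ.^ (j ∸ i ℕ.+ e)               ≡⟨ ≡.cong (λ n → p ℕ.^ (j ∸ i ℕ.+ n)) (ℕₚ.m+[n∸m]≡n i≤e) ⟨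
  p ℕ.^ (j ∸ i ℕ.+ (i ℕ.+ (e ∸ i))) ≡⟨ ≡.cong (p ℕ.^_) (ℕₚ.+-assoc (j ∸ i) i (e ∸ i)) ⟨
  p ℕ.^ (j ∸ i ℕ.+ i ℕ.+ (e ∸ i))   ≡⟨ ≡.cong (λ n → p ℕ.^ (n ℕ.+ (e ∸ i))) (ℕₚ.m∸n+n≡m i≤j) ⟩
  p ℕ.^ (j ℕ.+ (e ∸ i))             ≡⟨ ℕₚ.^-distribˡ-+-* p j (e ∸ i) ⟩
  p ℕ.^ j ℕ.* p ℕ.^ (e ∸ i)         ∎
  where open ≡.≡-Reasoning

Nontrivial : CommutativeRing 0ℓ 0ℓ → Set
Nontrivial K = ¬ 1# ≈ 0#
  where open CommutativeRing K

Cancellative : CommutativeRing 0ℓ 0ℓ → Set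
Cancellative K = ∀ x y z → x * z ≈ y * z → x ≈ y ⊎ z ≈ 0#
  where open CommutativeRing K

module DomainProperties (K : CommutativeRing 0ℓ 0ℓ) (1≉0 : Nontrivial K) (cancel : Cancellative K) where
  open CommutativeRing K renaming (zero to *-zero)
  open RingProperties K
  open import Relation.Binary.Reasoning.Setoid setoid
  open import Algebra.Solver.Ring.NaturalCoefficients.Default commutativeSemiring
    using (solve; _:+_; _:*_; _:=_)

  -- m x + y = m x′ + y′ and m′ x + y = m′ x′ + y′ give m (x - x′) = m′ (x - x′).
  lines-independent : ∀ {m m′ x x′ y y′} → m * x + y ≈ m * x′ + y′ → m′ * x + y ≈ m′ * x′ + y′ →
                      m ≈ m′ ⊎ x ≈ x′
  lines-independent {m} {m′} {x} {x′} {y} {y′} eq eq′ = Sum.map₂ (x∙y⁻¹≈ε⇒x≈y x x′) (cancel _ _ _ (begin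
    m * (x - x′)                                ≈⟨ x[y-z]≈xy-xz m x x′ ⟩
    m * x - m * x′                              ≈⟨ +-congʳ (+-identityʳ _) ⟨
    m * x + 0# - m * x′                         ≈⟨ +-congʳ (+-congˡ (-‿inverseʳ (m′ * x′))) ⟨
    m * x + (m′ * x′ - m′ * x′) - m * x′
      ≈⟨ solve 4 (λ a b c d → a :+ (b :+ c) :+ d := (a :+ b) :+ (c :+ d)) refl (m * x) (m′ * x′) (- (m′ * x′)) (- (m * x′)) ⟩
    (m * x + m′ * x′) + (- (m′ * x′) - m * x′)  ≈⟨ +-congʳ crossed ⟩
    (m * x′ + m′ * x) + (- (m′ * x′) - m * x′)
      ≈⟨ solve 4 (λ a b c d → (a :+ b) :+ (c :+ d) := (b :+ c) :+ (a :+ d)) refl (m * x′) (m′ * x) (- (m′ * x′)) (- (m * x′)) ⟩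
    (m′ * x - m′ * x′) + (m * x′ - m * x′)      ≈⟨ +-congˡ (-‿inverseʳ (m * x′)) ⟩
    (m′ * x - m′ * x′) + 0#                     ≈⟨ +-identityʳ _ ⟩
    m′ * x - m′ * x′                            ≈⟨ x[y-z]≈xy-xz m′ x x′ ⟨
    m′ * (x - x′)                               ∎))
    where
    crossed : m * x + m′ * x′ ≈ m * x′ + m′ * x
    crossed = +-cancelʳ (y + y′) _ _ (begin
      m * x + m′ * x′ + (y + y′)
        ≈⟨ solve 4 (λ a b c d → a :+ b :+ (c :+ d) := (a :+ c) :+ (b :+ d)) refl (m * x) (m′ * x′) y y′ ⟩
      (m * x + y) + (m′ * x′ + y′)    ≈⟨ +-cong eq (sym eq′) ⟩
      (m * x′ + y′) + (m′ * x + y)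
        ≈⟨ solve 4 (λ a b c d → (a :+ d) :+ (b :+ c) := a :+ b :+ (c :+ d)) refl (m * x′) (m′ * x) y y′ ⟩
      m * x′ + m′ * x + (y + y′)      ∎)

  eval : ∀ {n} → (Fin n → Carrier) → Carrier → Carrier
  eval {zero}  f x = 0#
  eval {suc n} f x = f zero + x * eval (f ∘ suc) x

  -- Synthetic division by X - a.
  divide : ∀ {n} → Carrier → (Fin (suc n) → Carrier) → Fin n → Carrier
  divide {suc n} a f zero    = eval (f ∘ suc) a
  divide {suc n} a f (suc i) = divide a (f ∘ suc) i

  divide-eval : ∀ {n} (f : Fin (suc n) → Carrier) a x →
                eval f x + a * eval (divide a f) x ≈ x * eval (divide a f) x + eval f a
  divide-eval {zero}  f a x =
    trans (+-cong (+-congˡ (zeroʳ x)) (zeroʳ a))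
      (trans (+-comm _ _) (sym (+-cong (zeroʳ x) (+-congˡ (zeroʳ a)))))
  divide-eval {suc n} f a x = begin
    c + x * q x + a * (q a + x * g)
      ≈⟨ solve 6 (λ c x qx a qa g → c :+ x :* qx :+ a :* (qa :+ x :* g) := c :+ x :* (qx :+ a :* g) :+ a :* qa) refl c x (q x) a (q a) g ⟩
    c + x * (q x + a * g) + a * q a   ≈⟨ +-congʳ (+-congˡ (*-congˡ (divide-eval (f ∘ suc) a x))) ⟩
    c + x * (x * g + q a) + a * q a
      ≈⟨ solve 5 (λ c x a qa g → c :+ x :* (x :* g :+ qa) :+ a :* qa := x :* (qa :+ x :* g) :+ (c :+ a :* qa)) refl c x a (q a) g ⟩
    x * (q a + x * g) + (c + a * q a) ∎
    where
    c = f zero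
    q = eval (f ∘ suc)
    g = eval (divide a (f ∘ suc)) x

  divide≈0 : ∀ {n} (f : Fin (suc n) → Carrier) a → (∀ i → divide a f i ≈ 0#) →
             eval f a ≈ 0# → ∀ i → f i ≈ 0#
  divide≈0 {zero} f a _ fa≈0 zero = trans (sym (trans (+-congˡ (zeroʳ a)) (+-identityʳ _))) fa≈0
  divide≈0 {suc n} f a g≈0 fa≈0 zero    =
    trans (sym (trans (+-congˡ (trans (*-congˡ (g≈0 zero)) (zeroʳ a))) (+-identityʳ _))) fa≈0
  divide≈0 {suc n} f a g≈0 fa≈0 (suc i) = divide≈0 (f ∘ suc) a (g≈0 ∘ suc) (g≈0 zero) i

  roots⇒≈0 : ∀ {n} (f : Fin n → Carrier) (x : Fin n → Carrier) → (∀ i j → x i ≈ x j → i ≡ j) →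
             (∀ i → eval f (x i) ≈ 0#) → ∀ i → f i ≈ 0#
  roots⇒≈0 {suc n} f x x-injective fx≈0 =
    divide≈0 f a (roots⇒≈0 (divide a f) (x ∘ suc) (λ i j eq → suc-injective (x-injective _ _ eq)) root) (fx≈0 zero)
    where
    a = x zero
    root : ∀ i → eval (divide a f) (x (suc i)) ≈ 0#
    root i = [ (λ a≈b → contradiction (x-injective zero (suc i) a≈b) λ ()) , (λ z → z) ]′ (cancel _ _ _ (begin
      a * g               ≈⟨ +-identityˡ _ ⟨
      0# + a * g          ≈⟨ +-congʳ (fx≈0 (suc i)) ⟨
      eval f b + a * g    ≈⟨ divide-eval f a b ⟩
      b * g + eval f a    ≈⟨ +-congˡ (fx≈0 zero) ⟩
      b * g + 0#          ≈⟨ +-identityʳ _ ⟩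
      b * g               ∎))
      where
      b = x (suc i)
      g = eval (divide a f) b

  monomial : ∀ m → Fin (suc m) → Carrier
  monomial zero    _       = 1#
  monomial (suc m) zero    = 0#
  monomial (suc m) (suc i) = monomial m i

  eval-monomial : ∀ m x → eval (monomial m) x ≈ x ^ m
  eval-monomial zero    x = trans (+-congˡ (zeroʳ x)) (+-identityʳ 1#)
  eval-monomial (suc m) x = trans (+-identityˡ _) (*-congˡ (eval-monomial m x))

  monomial-last : ∀ m → monomial m (fromℕ m) ≈ 1#
  monomial-last zero    = refl
  monomial-last (suc m) = monomial-last m

  module _ (_≟_ : Decidable _≈_) where

    -- Otherwise X ^ q - X would have q + 1 roots.
    injective⇒surjective : ∀ {q} → 2 ≤ q → (∀ x → x ^ q ≈ x) →
                           (g : Fin q → Carrier) → (∀ i j → g i ≈ g j → i ≡ j) → ∀ x → ∃ λ i → g i ≈ x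
    injective⇒surjective {suc (suc q)} (s≤s (s≤s z≤n)) x^q≈x g g-injective x with any? (λ i → g i ≟ x)
    ... | yes found = found
    ... | no  none  = contradiction (trans (sym (monomial-last q)) (roots⇒≈0 f y y-injective root (suc (suc (fromℕ q))))) 1≉0
      where
      f : Fin (suc (suc (suc q))) → Carrier
      f zero          = 0#
      f (suc zero)    = - 1#
      f (suc (suc i)) = monomial q i
      y : Fin (suc (suc (suc q))) → Carrier
      y zero    = x
      y (suc i) = g i
      y-injective : ∀ i j → y i ≈ y j → i ≡ j
      y-injective zero    zero    _  = ≡.refl
      y-injective zero    (suc j) eq = contradiction (j , sym eq) none
      y-injective (suc i) zero    eq = contradiction (i , eq) none
      y-injective (suc i) (suc j) eq = ≡.cong suc (g-injective i j eq)
      root : ∀ i → eval f (y i) ≈ 0#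
      root i = begin
        0# + u * (- 1# + u * eval (monomial q) u) ≈⟨ +-identityˡ _ ⟩
        u * (- 1# + u * eval (monomial q) u)      ≈⟨ *-congˡ (+-congˡ (*-congˡ (eval-monomial q u))) ⟩
        u * (- 1# + u ^ suc q)                    ≈⟨ distribˡ u _ _ ⟩
        u * - 1# + u ^ suc (suc q)                ≈⟨ +-cong (trans (*-comm u _) (-1*x≈-x u)) (x^q≈x u) ⟩
        - u + u                                   ≈⟨ -‿inverseˡ u ⟩
        0#                                        ∎
        where u = y i

  eval-difference : ∀ {n} (f g : Fin n → Carrier) x → eval (λ i → f i - g i) x ≈ eval f x - eval g x
  eval-difference {zero}  f g x = sym (-‿inverseʳ 0#)
  eval-difference {suc n} f g x = begin
    (a - b) + x * eval (λ i → f (suc i) - g (suc i)) x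
      ≈⟨ +-congˡ (*-congˡ (eval-difference (f ∘ suc) (g ∘ suc) x)) ⟩
    (a - b) + x * (u - v)               ≈⟨ +-congˡ (x[y-z]≈xy-xz x u v) ⟩
    (a - b) + (x * u - x * v)
      ≈⟨ solve 4 (λ a b c d → (a :+ b) :+ (c :+ d) := (a :+ c) :+ (b :+ d)) refl a (- b) (x * u) (- (x * v)) ⟩
    (a + x * u) + (- b - x * v)         ≈⟨ +-congˡ (-‿+-comm b (x * v)) ⟩
    (a + x * u) - (b + x * v)           ∎
    where
    a = f zero
    b = g zero
    u = eval (f ∘ suc) x
    v = eval (g ∘ suc) x

  module Characteristic {p} (pr : Prime p) (p×1≈0 : p × 1# ≈ 0#) where

    ×1≉0 : ∀ d .{{_ : NonZero d}} → d < p → ¬ d × 1# ≈ 0#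
    ×1≉0 d d<p d×1≈0 = 1≉0 (case (coprime-Bézout (prime⇒coprime pr d<p)))
      where
      kill : ∀ {m} → m × 1# ≈ 0# → ∀ k → (k ℕ.* m) × 1# ≈ 0#
      kill {m} m×1≈0 k = trans (×1-homo-* k m) (trans (*-congˡ m×1≈0) (zeroʳ _))
      combine≈ : ∀ {a b} → 1 ℕ.+ a ≡ b → a × 1# ≈ 0# → b × 1# ≈ 0# → 1# ≈ 0#
      combine≈ {a} ≡.refl a≈0 b≈0 = trans (sym (+-identityʳ 1#)) (trans (+-congˡ (sym a≈0)) b≈0)
      case : Bézout.Identity 1 p d → 1# ≈ 0#
      case (Bézout.+- x y eq) = combine≈ eq (kill d×1≈0 y) (kill p×1≈0 x)
      case (Bézout.-+ x y eq) = combine≈ eq (kill p×1≈0 x) (kill d×1≈0 y)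

    ×1-injective-< : ∀ {m n} → m < n → n < p → ¬ m × 1# ≈ n × 1#
    ×1-injective-< {m} {n} m<n n<p eq =
      ×1≉0 (n ∸ m) {{ℕ.>-nonZero (ℕₚ.m<n⇒0<n∸m m<n)}} (ℕₚ.≤-<-trans (ℕₚ.m∸n≤m n m) n<p)
        (+-cancelˡ (m × 1#) _ _ (begin
          m × 1# + (n ∸ m) × 1#  ≈⟨ ×-homo-+ 1# m (n ∸ m) ⟨
          (m ℕ.+ (n ∸ m)) × 1#   ≈⟨ ×-congˡ (ℕₚ.m+[n∸m]≡n (ℕₚ.<⇒≤ m<n)) ⟩
          n × 1#                 ≈⟨ eq ⟨
          m × 1#                 ≈⟨ +-identityʳ _ ⟨
          m × 1# + 0#            ∎))

    ×1-injective : ∀ {m n} → m < p → n < p → m × 1# ≈ n × 1# → m ≡ n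
    ×1-injective {m} {n} m<p n<p eq with ℕₚ.<-cmp m n
    ... | tri< m<n _ _ = contradiction eq (×1-injective-< m<n n<p)
    ... | tri≈ _ m≡n _ = m≡n
    ... | tri> _ _ n<m = contradiction (sym eq) (×1-injective-< n<m m<p)

    1^n≈1 : ∀ n → 1# ^ n ≈ 1#
    1^n≈1 zero    = refl
    1^n≈1 (suc n) = trans (*-identityˡ _) (1^n≈1 n)

    frobenius-×1 : ∀ j n → (n × 1#) ^ (p ℕ.^ j) ≈ n × 1#
    frobenius-×1 j zero    = 0^[p^j]≈0 pr p×1≈0 j
    frobenius-×1 j (suc n) =
      trans (frobenius^-+ pr p×1≈0 j 1# (n × 1#)) (+-cong (1^n≈1 (p ℕ.^ j)) (frobenius-×1 j n))

    polynomial : ∀ {n} → (Fin n → Fin p) → Fin n → Carrier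
    polynomial c i = toℕ (c i) × 1#

    frobenius-eval : ∀ j {n} (c : Fin n → Fin p) x →
                     eval (polynomial c) x ^ (p ℕ.^ j) ≈ eval (polynomial c) (x ^ (p ℕ.^ j))
    frobenius-eval j {zero}  c x = 0^[p^j]≈0 pr p×1≈0 j
    frobenius-eval j {suc n} c x =
      trans (frobenius^-+ pr p×1≈0 j _ _)
        (+-cong (frobenius-×1 j (toℕ (c zero)))
          (trans (^-distrib-* x _ (p ℕ.^ j)) (*-congˡ (frobenius-eval j (c ∘ suc) x))))

    module _ (e : ℕ) (x^q≈x : ∀ x → x ^ (p ℕ.^ e) ≈ x)
             (α : Carrier) (α-degree : ∀ i → 0 < i → i < e → ¬ α ^ (p ℕ.^ i) ≈ α) where

      conjugate : Fin e → Carrier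
      conjugate i = α ^ (p ℕ.^ toℕ i)

      conjugate-< : ∀ {i j} → i < j → j < e → ¬ α ^ (p ℕ.^ i) ≈ α ^ (p ℕ.^ j)
      conjugate-< {i} {j} i<j j<e eq =
        α-degree (j ∸ i) (ℕₚ.m<n⇒0<n∸m i<j) (ℕₚ.≤-<-trans (ℕₚ.m∸n≤m j i) j<e) (begin
          α ^ (p ℕ.^ (j ∸ i))                              ≈⟨ x^q≈x _ ⟨
          (α ^ (p ℕ.^ (j ∸ i))) ^ (p ℕ.^ e)                ≈⟨ ^-assocʳ α (p ℕ.^ (j ∸ i)) (p ℕ.^ e) ⟩
          α ^ (p ℕ.^ (j ∸ i) ℕ.* p ℕ.^ e)                  ≈⟨ ^-congʳ α (^-*-exchange p (ℕₚ.<⇒≤ i<j) i≤e) ⟩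
          α ^ (p ℕ.^ j ℕ.* p ℕ.^ (e ∸ i))                  ≈⟨ ^-assocʳ α (p ℕ.^ j) (p ℕ.^ (e ∸ i)) ⟨
          (α ^ (p ℕ.^ j)) ^ (p ℕ.^ (e ∸ i))                ≈⟨ ^-congˡ (p ℕ.^ (e ∸ i)) eq ⟨
          (α ^ (p ℕ.^ i)) ^ (p ℕ.^ (e ∸ i))                ≈⟨ ^-assocʳ α (p ℕ.^ i) (p ℕ.^ (e ∸ i)) ⟩
          α ^ (p ℕ.^ i ℕ.* p ℕ.^ (e ∸ i))
            ≈⟨ ^-congʳ α (≡.sym (ℕₚ.^-distribˡ-+-* p i (e ∸ i))) ⟩
          α ^ (p ℕ.^ (i ℕ.+ (e ∸ i)))                      ≈⟨ ^-congʳ α (≡.cong (p ℕ.^_) (ℕₚ.m+[n∸m]≡n i≤e)) ⟩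
          α ^ (p ℕ.^ e)                                    ≈⟨ x^q≈x α ⟩
          α                                                ∎)
        where
        i≤e : i ≤ e
        i≤e = ℕₚ.<⇒≤ (ℕₚ.<-trans i<j j<e)

      conjugate-injective : ∀ i j → conjugate i ≈ conjugate j → i ≡ j
      conjugate-injective i j eq with ℕₚ.<-cmp (toℕ i) (toℕ j)
      ... | tri< i<j _ _ = contradiction eq (conjugate-< i<j (toℕ<n j))
      ... | tri≈ _ i≡j _ = toℕ-injective i≡j
      ... | tri> _ _ j<i = contradiction (sym eq) (conjugate-< j<i (toℕ<n i))

      element : Fin (p ℕ.^ e) → Carrier
      element i = eval (polynomial (finToFun {p} {e} i)) α

      -- A polynomial over the prime field that vanishes at α vanishes at all conjugates of α.
      element-injective : ∀ i j → element i ≈ element j → i ≡ j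
      element-injective i j eq = finToFun-injective {p} {e} λ l →
        toℕ-injective (×1-injective (toℕ<n _) (toℕ<n _)
          (x∙y⁻¹≈ε⇒x≈y _ _ (roots⇒≈0 _ conjugate conjugate-injective root l)))
        where
        f g : Fin e → Carrier
        f = polynomial (finToFun {p} {e} i)
        g = polynomial (finToFun {p} {e} j)
        root : ∀ l → eval (λ t → f t - g t) (conjugate l) ≈ 0#
        root l = trans (eval-difference f g _) (x≈y⇒x∙y⁻¹≈ε (begin
          eval f (conjugate l)            ≈⟨ frobenius-eval (toℕ l) (finToFun {p} {e} i) α ⟨
          eval f α ^ (p ℕ.^ toℕ l)        ≈⟨ ^-congˡ (p ℕ.^ toℕ l) eq ⟩
          eval g α ^ (p ℕ.^ toℕ l)        ≈⟨ frobenius-eval (toℕ l) (finToFun {p} {e} j) α ⟩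
          eval g (conjugate l)            ∎))

-- Fields of prime power order

open import Data.Product.Base using (Σ-syntax; _×_)

-- A field of order k, reduced to what the plane needs: incidence m x y is the
-- intercept b of the line through (x , y) with equation m x + y = b.
record LinearTernary (k : ℕ) : Set where
  field
    intercept   : Fin k → Fin k → Fin k → Fin k
    injective   : ∀ m x {y y′} → intercept m x y ≡ intercept m x y′ → y ≡ y′
    surjective  : ∀ m x b → ∃ λ y → intercept m x y ≡ b
    independent : ∀ {m m′ x x′ y y′} → intercept m x y ≡ intercept m x′ y′ →
                  intercept m′ x y ≡ intercept m′ x′ y′ → m ≡ m′ ⊎ x ≡ x′

-- The quotient of a commutative ring by the annihilator of ε.
module Quotient (R : CommutativeRing 0ℓ 0ℓ) (ε : CommutativeRing.Carrier R) where
  open CommutativeRing R renaming (zero to *-zero)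
  open import Relation.Binary.Reasoning.Setoid setoid
  open import Algebra.Solver.Ring.NaturalCoefficients.Default commutativeSemiring
    using (solve; _:+_; _:*_; _:=_)
  open import Algebra.Properties.Ring ring using (-‿distribʳ-*)

  infix 4 _∼_

  _∼_ : Carrier → Carrier → Set
  x ∼ y = ε * x ≈ ε * y

  ∼-isCommutativeRing : IsCommutativeRing _∼_ _+_ _*_ -_ 0# 1#
  ∼-isCommutativeRing = record
    { isRing = record
      { +-isAbelianGroup = record
        { isGroup = record
          { isMonoid = record
            { isSemigroup = record
              { isMagma = record
                { isEquivalence = record { refl = refl ; sym = sym ; trans = trans }
                ; ∙-cong = λ p q → trans (distribˡ _ _ _) (trans (+-cong p q) (sym (distribˡ _ _ _))) }
              ; assoc = λ x y z → *-congˡ (+-assoc x y z) }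
            ; identity = (λ x → *-congˡ (+-identityˡ x)) , (λ x → *-congˡ (+-identityʳ x)) }
          ; inverse = (λ x → *-congˡ (-‿inverseˡ x)) , (λ x → *-congˡ (-‿inverseʳ x))
          ; ⁻¹-cong = λ p → trans (sym (-‿distribʳ-* _ _)) (trans (-‿cong p) (-‿distribʳ-* _ _)) }
        ; comm = λ x y → *-congˡ (+-comm x y) }
      ; *-cong = λ {x} {y} {u} {v} p q → begin
          ε * (x * u) ≈⟨ *-assoc ε x u ⟨
          (ε * x) * u ≈⟨ *-congʳ p ⟩
          (ε * y) * u ≈⟨ solve 3 (λ e y u → (e :* y) :* u := y :* (e :* u)) refl ε y u ⟩
          y * (ε * u) ≈⟨ *-congˡ q ⟩
          y * (ε * v) ≈⟨ solve 3 (λ e y v → y :* (e :* v) := e :* (y :* v)) refl ε y v ⟩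
          ε * (y * v) ∎
      ; *-assoc = λ x y z → *-congˡ (*-assoc x y z)
      ; *-identity = (λ x → *-congˡ (*-identityˡ x)) , (λ x → *-congˡ (*-identityʳ x))
      ; distrib = (λ x y z → *-congˡ (distribˡ x y z)) , (λ x y z → *-congˡ (distribʳ x y z)) }
    ; *-comm = λ x y → *-congˡ (*-comm x y) }

  quotient : CommutativeRing 0ℓ 0ℓ
  quotient = record { isCommutativeRing = ∼-isCommutativeRing }

  private
    module R = RingProperties R
    module Q = RingProperties quotient

  ×-quotient : ∀ n x → n Q.× x ≡ n R.× x
  ×-quotient zero    x = ≡.refl
  ×-quotient (suc n) x = ≡.cong (x +_) (×-quotient n x)

  ^-quotient : ∀ x n → x Q.^ n ≡ x R.^ n
  ^-quotient x zero    = ≡.refl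
  ^-quotient x (suc n) = ≡.cong (x *_) (^-quotient x n)

FixedByPower : CommutativeRing 0ℓ 0ℓ → ℕ → Set
FixedByPower R q = ∀ x → x ^ q ≈ x
  where
  open CommutativeRing R
  open RingProperties R using (_^_)

module Separation (R : CommutativeRing 0ℓ 0ℓ) (_≟_ : Decidable (CommutativeRing._≈_ R))
  {q} (2≤q : 2 ≤ q) (x^q≈x : FixedByPower R q) where
  open CommutativeRing R renaming (zero to *-zero)
  open RingProperties R using (_^_)
  open import Relation.Binary.Reasoning.Setoid setoid
  open import Algebra.Solver.Ring.NaturalCoefficients.Default commutativeSemiring
    using (solve; _:+_; _:*_; _:=_)

  x*x*x^[q-2]≈x : ∀ x → x * (x * x ^ (q ∸ 2)) ≈ x
  x*x*x^[q-2]≈x x = go 2≤q (x^q≈x x)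
    where
    go : ∀ {q} → 2 ≤ q → x ^ q ≈ x → x * (x * x ^ (q ∸ 2)) ≈ x
    go (s≤s (s≤s z≤n)) eq = eq

  x²≈0⇒x≈0 : ∀ x → x * x ≈ 0# → x ≈ 0#
  x²≈0⇒x≈0 x x²≈0 = begin
    x                       ≈⟨ x*x*x^[q-2]≈x x ⟨
    x * (x * x ^ (q ∸ 2))   ≈⟨ *-assoc x x _ ⟨
    (x * x) * x ^ (q ∸ 2)   ≈⟨ *-congʳ x²≈0 ⟩
    0# * x ^ (q ∸ 2)        ≈⟨ zeroˡ _ ⟩
    0#                      ∎

  -- The image of a in the quotient by the annihilator of ε is zero or a unit.
  Separates : Carrier → Carrier → Set
  Separates ε a = ε * a ≈ 0# ⊎ ∃ λ b → ε * (a * b) ≈ ε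

  separates-* : ∀ {ε a} t → Separates ε a → Separates (ε * t) a
  separates-* {ε} {a} t (inj₁ εa≈0) = inj₁ (begin
    (ε * t) * a   ≈⟨ solve 3 (λ e t a → (e :* t) :* a := t :* (e :* a)) refl ε t a ⟩
    t * (ε * a)   ≈⟨ *-congˡ εa≈0 ⟩
    t * 0#        ≈⟨ zeroʳ t ⟩
    0#            ∎)
  separates-* {ε} {a} t (inj₂ (b , εab≈ε)) = inj₂ (b , (begin
    (ε * t) * (a * b)   ≈⟨ solve 4 (λ e t a b → (e :* t) :* (a :* b) := (e :* (a :* b)) :* t) refl ε t a b ⟩
    (ε * (a * b)) * t   ≈⟨ *-congʳ εab≈ε ⟩
    ε * t               ∎))

  separates-cong : ∀ {ε ε′ a a′} → ε ≈ ε′ → a ≈ a′ → Separates ε a → Separates ε′ a′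
  separates-cong p r (inj₁ z)       = inj₁ (trans (*-cong (sym p) (sym r)) z)
  separates-cong p r (inj₂ (b , z)) = inj₂ (b , trans (*-cong (sym p) (*-congʳ (sym r))) (trans z p))

  separateAll : ∀ as ε → ¬ ε ≈ 0# → ∃ λ t → ¬ ε * t ≈ 0# × All (Separates (ε * t)) as
  separateAll [] ε ε≉0 = 1# , (λ eq → ε≉0 (trans (sym (*-identityʳ ε)) eq)) , []
  separateAll (a ∷ as) ε ε≉0 with (ε * a) ≟ 0#
  ... | yes εa≈0 with t , εt≉0 , rest ← separateAll as ε ε≉0 =
    t , εt≉0 , separates-* t (inj₁ εa≈0) ∷ rest
  ... | no εa≉0 with t , εat≉0 , rest ← separateAll as (ε * a) εa≉0 =
    a * t , (λ eq → εat≉0 (trans (*-assoc ε a t) eq)) ,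
    All.map (separates-cong (*-assoc ε a t) refl) (separates-* t unit ∷ rest)
    where
    unit : Separates (ε * a) a
    unit = inj₂ (a ^ (q ∸ 2) , trans (*-assoc ε a _) (*-congˡ (x*x*x^[q-2]≈x a)))

module Construction (R : CommutativeRing 0ℓ 0ℓ) where
  open CommutativeRing R renaming (zero to *-zero)
  open RingProperties R hiding (_×_)
  open RingProperties R using () renaming (_×_ to _·_)

  conjugateDifferences : Carrier → ℕ → ℕ → Carrier
  conjugateDifferences α p zero    = 1#
  conjugateDifferences α p (suc k) = (α ^ (p ℕ.^ suc k) - α) * conjugateDifferences α p k

  conjugate-∣ : ∀ α p {i k} → 0 < i → i ≤ k → ∃ λ t → conjugateDifferences α p k ≈ (α ^ (p ℕ.^ i) - α) * t
  conjugate-∣ α p {i} {zero} (s≤s _) ()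
  conjugate-∣ α p {i} {suc k} 0<i i≤1+k with ℕₚ.m≤n⇒m<n∨m≡n i≤1+k
  ... | inj₂ ≡.refl = conjugateDifferences α p k , refl
  ... | inj₁ (s≤s i≤k) with t , eq ← conjugate-∣ α p 0<i i≤k =
    _ * t , trans (*-congˡ eq) (solve 3 (λ u v t → u :* (v :* t) := v :* (u :* t)) refl _ _ t)
    where open import Algebra.Solver.Ring.NaturalCoefficients.Default commutativeSemiring
            using (solve; _:*_; _:=_)

  module _ {p e} (pr : Prime p) (p·1≈0 : p · 1# ≈ 0#) (2≤q : 2 ≤ p ℕ.^ suc e)
    (_≟_ : Decidable _≈_) (x^q≈x : ∀ x → x ^ (p ℕ.^ suc e) ≈ x)
    (elements : List Carrier) (∈elements : ∀ x → Any (x ≈_) elements)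
    (α : Carrier) (Q≉0 : ¬ conjugateDifferences α p e ≈ 0#) where

    open Separation R _≟_ 2≤q x^q≈x

    linearTernary : LinearTernary (p ℕ.^ suc e)
    linearTernary with t , ε≉0 , separates ← separateAll elements (conjugateDifferences α p e) Q≉0 = record
      { intercept   = λ m x y → index (el m K.* el x K.+ el y)
      ; injective   = λ m x eq → el-injective _ _ (KP.+-cancelˡ (el m K.* el x) _ _ (index-injective eq))
      ; surjective  = λ m x b → index (el b K.- el m K.* el x) ,
          el-injective _ _ (K.trans (el-index _)
            (K.trans (K.+-congˡ {el m K.* el x} (el-index (el b K.- el m K.* el x))) (x+[y-x]≈y _ _)))
      ; independent = λ eq eq′ → [ (λ p → inj₁ (el-injective _ _ p)) , (λ p → inj₂ (el-injective _ _ p)) ]′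
          (lines-independent (index-injective eq) (index-injective eq′))
      }
      where
      Q = conjugateDifferences α p e
      ε = Q * t
      open Quotient R ε
      module K = CommutativeRing quotient
      module KP = RingProperties quotient
      open import Algebra.Solver.Ring.NaturalCoefficients.Default commutativeSemiring
        using (solve; _:+_; _:*_; _:=_)

      separates-any : ∀ a → Separates ε a
      separates-any a = go (∈elements a) separates
        where
        go : ∀ {as} → Any (a ≈_) as → All (Separates ε) as → Separates ε a
        go (here a≈b) (s ∷ _)  = separates-cong refl (sym a≈b) s
        go (there i)  (_ ∷ ss) = go i ss

      1≁0 : Nontrivial quotient
      1≁0 eq = ε≉0 (trans (sym (*-identityʳ ε)) (trans eq (zeroʳ ε)))

      cancel : Cancellative quotient
      cancel x y z eq with separates-any z
      ... | inj₁ εz≈0 = inj₂ (trans εz≈0 (sym (zeroʳ ε)))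
      ... | inj₂ (b , εzb≈ε) = inj₁ (begin
        ε * x             ≈⟨ *-congʳ εzb≈ε ⟨
        ε * (z * b) * x   ≈⟨ rearrange x ⟩
        ε * (x * z) * b   ≈⟨ *-congʳ eq ⟩
        ε * (y * z) * b   ≈⟨ rearrange y ⟨
        ε * (z * b) * y   ≈⟨ *-congʳ εzb≈ε ⟩
        ε * y             ∎)
        where
        open import Relation.Binary.Reasoning.Setoid setoid
        rearrange : ∀ x → ε * (z * b) * x ≈ ε * (x * z) * b
        rearrange x = solve 4 (λ e z b x → e :* (z :* b) :* x := e :* (x :* z) :* b) refl ε z b x

      open DomainProperties quotient 1≁0 cancel
      open Characteristic pr (≡.subst (_∼ 0#) (≡.sym (×-quotient p 1#)) (*-congˡ p·1≈0))

      x^q∼x : ∀ x → x KP.^ (p ℕ.^ suc e) ∼ x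
      x^q∼x x = ≡.subst (_∼ x) (≡.sym (^-quotient x (p ℕ.^ suc e))) (*-congˡ (x^q≈x x))

      α-degree : ∀ i → 0 < i → i < suc e → ¬ α KP.^ (p ℕ.^ i) ∼ α
      α-degree i 0<i (s≤s i≤e) eq with s , Q≈ds ← conjugate-∣ α p 0<i i≤e =
        ε≉0 (x²≈0⇒x≈0 ε (begin
          ε * (Q * t)         ≈⟨ *-congˡ (*-congʳ Q≈ds) ⟩
          ε * (d * s * t)     ≈⟨ solve 4 (λ e d s t → e :* (d :* s :* t) := e :* d :* (s :* t)) refl ε d s t ⟩
          ε * d * (s * t)     ≈⟨ *-congʳ εd≈0 ⟩
          0# * (s * t)        ≈⟨ zeroˡ _ ⟩
          0#                  ∎))
        where
        open import Relation.Binary.Reasoning.Setoid setoid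
        d = α ^ (p ℕ.^ i) - α
        εd≈0 : ε * d ≈ 0#
        εd≈0 = trans (KP.x≈y⇒x∙y⁻¹≈ε (≡.subst (_∼ α) (^-quotient α (p ℕ.^ i)) eq)) (zeroʳ ε)

      el : Fin (p ℕ.^ suc e) → Carrier
      el = element (suc e) x^q∼x α α-degree

      el-injective : ∀ i j → el i ∼ el j → i ≡ j
      el-injective = element-injective (suc e) x^q∼x α α-degree

      el-surjective : ∀ x → ∃ λ i → el i ∼ x
      el-surjective = injective⇒surjective (λ x y → (ε * x) ≟ (ε * y)) 2≤q x^q∼x el el-injective

      index : Carrier → Fin (p ℕ.^ suc e)
      index x = proj₁ (el-surjective x)

      el-index : ∀ x → el (index x) ∼ x
      el-index x = proj₂ (el-surjective x)

      index-injective : ∀ {x y} → index x ≡ index y → x ∼ y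
      index-injective {x} {y} eq = trans (sym (el-index x)) (trans (*-congˡ (reflexive (≡.cong el eq))) (el-index y))

      x+[y-x]≈y : ∀ x y → x K.+ (y K.- x) ∼ y
      x+[y-x]≈y x y = *-congˡ (trans (+-congˡ (+-comm y (- x))) (trans (sym (+-assoc x (- x) y))
        (trans (+-congʳ (-‿inverseʳ x)) (+-identityˡ y))))

-- The group ring

open import Data.Nat.Base using (_+_; _*_; _%_)
open import Data.Nat.ListAction using (sum)
open import Data.Nat.ListAction.Properties using (sum-++; sum-↭)
open import Relation.Binary.PropositionalEquality using (refl; sym; trans; cong; cong₂; subst)

private variable
  A B C : Set

∑ : List A → (A → ℕ) → ℕ
∑ xs f = sum (map f xs)

∑-++ : ∀ (xs ys : List A) f → ∑ (xs ++ ys) f ≡ ∑ xs f + ∑ ys f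
∑-++ xs ys f = trans (cong sum (List.map-++ f xs ys)) (sum-++ (map f xs) (map f ys))

∑-map : ∀ (g : A → B) xs f → ∑ (map g xs) f ≡ ∑ xs (f ∘ g)
∑-map g xs f = cong sum (sym (List.map-∘ xs))

∑-cong : ∀ (xs : List A) {f g} → (∀ x → f x ≡ g x) → ∑ xs f ≡ ∑ xs g
∑-cong xs eq = cong sum (List.map-cong eq xs)

∑-zero : ∀ (xs : List A) → ∑ xs (λ _ → 0) ≡ 0
∑-zero []       = refl
∑-zero (x ∷ xs) = ∑-zero xs

∑-+ : ∀ (xs : List A) f g → ∑ xs (λ x → f x + g x) ≡ ∑ xs f + ∑ xs g
∑-+ []       f g = refl
∑-+ (x ∷ xs) f g = trans (cong (f x + g x +_) (∑-+ xs f g)) (ℕ+.interchange (f x) (g x) _ _)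
  where import Algebra.Properties.CommutativeSemigroup ℕₚ.+-commutativeSemigroup as ℕ+

∑-swap : ∀ (xs : List A) (ys : List B) (f : A → B → ℕ) → ∑ xs (λ x → ∑ ys (f x)) ≡ ∑ ys (λ y → ∑ xs (λ x → f x y))
∑-swap []       ys f = sym (∑-zero ys)
∑-swap (x ∷ xs) ys f = trans (cong (∑ ys (f x) +_) (∑-swap xs ys f)) (sym (∑-+ ys (f x) λ y → ∑ xs λ x → f x y))

∑-cartesianProductWith : ∀ (g : A → B → C) xs ys (f : C → ℕ) →
                         ∑ (cartesianProductWith g xs ys) f ≡ ∑ xs (λ x → ∑ ys (λ y → f (g x y)))
∑-cartesianProductWith g []       ys f = refl
∑-cartesianProductWith g (x ∷ xs) ys f =
  trans (∑-++ (map (g x) ys) _ f) (cong₂ _+_ (∑-map (g x) ys f) (∑-cartesianProductWith g xs ys f))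

∑-const : ∀ (xs : List A) c → ∑ xs (λ _ → c) ≡ length xs * c
∑-const []       c = refl
∑-const (x ∷ xs) c = cong (c +_) (∑-const xs c)

∑-copies : ∀ m (xs : List A) f → ∑ (concat (replicate m xs)) f ≡ m * ∑ xs f
∑-copies zero    xs f = refl
∑-copies (suc m) xs f = trans (∑-++ xs _ f) (cong (∑ xs f +_) (∑-copies m xs f))

-- The group ring 𝔽ₚ[ℤ/n], which is 𝔽ₚ[X]/(Xⁿ - 1): a list of naturals stands
-- for the sum of the powers of X with these exponents.
module GroupRing (p n : ℕ) {{_ : NonZero p}} {{_ : NonZero n}} where

  Element : Set
  Element = List ℕ

  isZero : ℕ → ℕ
  isZero zero    = 1
  isZero (suc _) = 0

  divisible : ℕ → ℕ
  divisible i = isZero (i % n)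

  -- The coefficient of X^(-r).
  coefficient : Element → ℕ → ℕ
  coefficient a r = ∑ a (λ i → divisible (i + r))

  infix 4 _≈_ _≋_
  infixl 7 _⊛_

  record _≈_ (a b : Element) : Set where
    constructor mk
    field at : ∀ r → coefficient a r % p ≡ coefficient b r % p
  open _≈_

  _≋_ : Element → Element → Set
  a ≋ b = ∀ f → ∑ a f ≡ ∑ b f

  ≋⇒≈ : ∀ {a b} → a ≋ b → a ≈ b
  ≋⇒≈ eq .at r = cong (_% p) (eq _)

  _⊛_ : Element → Element → Element
  _⊛_ = cartesianProductWith _+_

  ⊖_ : Element → Element
  ⊖ a = concat (replicate (ℕ.pred p) a)

  ∑-⊛ : ∀ a b f → ∑ (a ⊛ b) f ≡ ∑ a (λ i → ∑ b (λ j → f (i + j)))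
  ∑-⊛ a b f = ∑-cartesianProductWith _+_ a b f

  %-+-cong : ∀ {x x′ y y′} → x % p ≡ x′ % p → y % p ≡ y′ % p → (x + y) % p ≡ (x′ + y′) % p
  %-+-cong {x} {x′} {y} {y′} eq eq′ =
    trans (%-distribˡ-+ x y p) (trans (cong₂ (λ u v → (u + v) % p) eq eq′) (sym (%-distribˡ-+ x′ y′ p)))

  %-*-congˡ : ∀ m {x y} → x % p ≡ y % p → (m * x) % p ≡ (m * y) % p
  %-*-congˡ m {x} {y} eq =
    trans (%-distribˡ-* m x p) (trans (cong (λ u → ((m % p) * u) % p) eq) (sym (%-distribˡ-* m y p)))

  ∑-%-cong : ∀ (xs : List A) {f g : A → ℕ} → (∀ x → f x % p ≡ g x % p) → ∑ xs f % p ≡ ∑ xs g % p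
  ∑-%-cong []       eq = refl
  ∑-%-cong (x ∷ xs) {f} {g} eq = %-+-cong {f x} {g x} (eq x) (∑-%-cong xs eq)

  ≈-refl : ∀ {a} → a ≈ a
  ≈-refl .at r = refl

  ≈-sym : ∀ {a b} → a ≈ b → b ≈ a
  ≈-sym eq .at r = sym (eq .at r)

  ≈-trans : ∀ {a b c} → a ≈ b → b ≈ c → a ≈ c
  ≈-trans eq eq′ .at r = trans (eq .at r) (eq′ .at r)

  ++-cong : ∀ {a a′ b b′} → a ≈ a′ → b ≈ b′ → a ++ b ≈ a′ ++ b′
  ++-cong {a} {a′} {b} {b′} eq eq′ .at r =
    subst (λ u → u % p ≡ _) (sym (∑-++ a b _))
      (subst (λ u → (coefficient a r + coefficient b r) % p ≡ u % p) (sym (∑-++ a′ b′ _))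
        (%-+-cong {coefficient a r} (eq .at r) (eq′ .at r)))

  ++-comm : ∀ a b → a ++ b ≋ b ++ a
  ++-comm a b f = trans (∑-++ a b f) (trans (ℕₚ.+-comm (∑ a f) _) (sym (∑-++ b a f)))

  ⊛-comm : ∀ a b → a ⊛ b ≋ b ⊛ a
  ⊛-comm a b f = trans (∑-⊛ a b f) (trans (∑-swap a b λ i j → f (i + j))
    (trans (∑-cong b λ i → ∑-cong a λ j → cong f (ℕₚ.+-comm j i)) (sym (∑-⊛ b a f))))

  ⊛-assoc : ∀ a b c → (a ⊛ b) ⊛ c ≋ a ⊛ (b ⊛ c)
  ⊛-assoc a b c f = begin
    ∑ ((a ⊛ b) ⊛ c) f                                  ≡⟨ ∑-⊛ (a ⊛ b) c f ⟩
    ∑ (a ⊛ b) (λ l → ∑ c (λ k → f (l + k)))            ≡⟨ ∑-⊛ a b _ ⟩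
    ∑ a (λ i → ∑ b (λ j → ∑ c (λ k → f (i + j + k))))
      ≡⟨ ∑-cong a (λ i → ∑-cong b λ j → ∑-cong c λ k → cong f (ℕₚ.+-assoc i j k)) ⟩
    ∑ a (λ i → ∑ b (λ j → ∑ c (λ k → f (i + (j + k))))) ≡⟨ ∑-cong a (λ i → ∑-⊛ b c _) ⟨
    ∑ a (λ i → ∑ (b ⊛ c) (λ l → f (i + l)))            ≡⟨ ∑-⊛ a (b ⊛ c) f ⟨
    ∑ (a ⊛ (b ⊛ c)) f                                  ∎
    where open ≡.≡-Reasoning

  ⊛-congˡ : ∀ a {b b′} → b ≈ b′ → a ⊛ b ≈ a ⊛ b′
  ⊛-congˡ a {b} {b′} eq .at r = begin
    coefficient (a ⊛ b) r % p                       ≡⟨ cong (_% p) (expand b) ⟩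
    ∑ a (λ i → coefficient b (i + r)) % p           ≡⟨ ∑-%-cong a (λ i → eq .at (i + r)) ⟩
    ∑ a (λ i → coefficient b′ (i + r)) % p          ≡⟨ cong (_% p) (expand b′) ⟨
    coefficient (a ⊛ b′) r % p                      ∎
    where
    open ≡.≡-Reasoning
    reassociate : ∀ i j → i + j + r ≡ j + (i + r)
    reassociate i j = trans (cong (_+ r) (ℕₚ.+-comm i j)) (ℕₚ.+-assoc j i r)
    expand : ∀ b → coefficient (a ⊛ b) r ≡ ∑ a (λ i → coefficient b (i + r))
    expand b = trans (∑-⊛ a b _)
      (∑-cong a λ i → ∑-cong b λ j → cong divisible (reassociate i j))

  ⊛-cong : ∀ {a a′ b b′} → a ≈ a′ → b ≈ b′ → a ⊛ b ≈ a′ ⊛ b′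
  ⊛-cong {a} {a′} {b} {b′} eq eq′ =
    ≈-trans (⊛-congˡ a eq′) (≈-trans (≋⇒≈ (⊛-comm a b′)) (≈-trans (⊛-congˡ b′ eq) (≋⇒≈ (⊛-comm b′ a′))))

  ⊛-identityˡ : ∀ a → [ 0 ] ⊛ a ≋ a
  ⊛-identityˡ a f = trans (∑-⊛ [ 0 ] a f) (ℕₚ.+-identityʳ _)

  ⊛-distribˡ : ∀ a b c → a ⊛ (b ++ c) ≋ a ⊛ b ++ a ⊛ c
  ⊛-distribˡ a b c f = begin
    ∑ (a ⊛ (b ++ c)) f                                                       ≡⟨ ∑-⊛ a (b ++ c) f ⟩
    ∑ a (λ i → ∑ (b ++ c) (λ j → f (i + j)))                                 ≡⟨ ∑-cong a (λ i → ∑-++ b c _) ⟩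
    ∑ a (λ i → ∑ b (λ j → f (i + j)) + ∑ c (λ j → f (i + j)))                ≡⟨ ∑-+ a _ _ ⟩
    ∑ a (λ i → ∑ b (λ j → f (i + j))) + ∑ a (λ i → ∑ c (λ j → f (i + j)))
      ≡⟨ cong₂ _+_ (∑-⊛ a b f) (∑-⊛ a c f) ⟨
    ∑ (a ⊛ b) f + ∑ (a ⊛ c) f                                                ≡⟨ ∑-++ (a ⊛ b) (a ⊛ c) f ⟨
    ∑ (a ⊛ b ++ a ⊛ c) f                                                     ∎
    where open ≡.≡-Reasoning

  ⊛-distribʳ : ∀ a b c → (b ++ c) ⊛ a ≋ b ⊛ a ++ c ⊛ a
  ⊛-distribʳ a b c f = trans (⊛-comm (b ++ c) a f) (trans (⊛-distribˡ a b c f)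
    (trans (∑-++ (a ⊛ b) _ f) (trans (cong₂ _+_ (⊛-comm a b f) (⊛-comm a c f)) (sym (∑-++ (b ⊛ a) _ f)))))

  copies≈0 : ∀ a → concat (replicate p a) ≈ []
  copies≈0 a .at r = begin
    ∑ (concat (replicate p a)) _ % p    ≡⟨ cong (_% p) (∑-copies p a _) ⟩
    (p * coefficient a r) % p           ≡⟨ cong (_% p) (ℕₚ.*-comm p _) ⟩
    (coefficient a r * p) % p           ≡⟨ m*n%n≡0 (coefficient a r) p ⟩
    0                                   ≡⟨ m*n%n≡0 0 p ⟨
    0 % p                               ∎
    where open ≡.≡-Reasoning

  ⊖-inverseʳ : ∀ a → a ++ ⊖ a ≈ []
  ⊖-inverseʳ a = subst (λ m → concat (replicate m a) ≈ []) (sym (ℕₚ.suc-pred p)) (copies≈0 a)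

  ⊖-cong : ∀ {a b} → a ≈ b → ⊖ a ≈ ⊖ b
  ⊖-cong {a} {b} eq .at r =
    trans (cong (_% p) (∑-copies (ℕ.pred p) a _))
      (trans (%-*-congˡ (ℕ.pred p) {coefficient a r} (eq .at r)) (sym (cong (_% p) (∑-copies (ℕ.pred p) b _))))

  groupRing : CommutativeRing 0ℓ 0ℓ
  groupRing = record
    { Carrier = Element ; _≈_ = _≈_ ; _+_ = _++_ ; _*_ = _⊛_ ; -_ = ⊖_ ; 0# = [] ; 1# = [ 0 ]
    ; isCommutativeRing = record
      { isRing = record
        { +-isAbelianGroup = record
          { isGroup = record
            { isMonoid = record
              { isSemigroup = record
                { isMagma = record
                  { isEquivalence = record { refl = ≈-refl ; sym = ≈-sym ; trans = ≈-trans }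
                  ; ∙-cong = ++-cong }
                ; assoc = λ a b c → ≋⇒≈ λ f → cong (λ l → ∑ l f) (List.++-assoc a b c) }
              ; identity = (λ a → ≈-refl) , (λ a → ≋⇒≈ λ f → cong (λ l → ∑ l f) (List.++-identityʳ a)) }
            ; inverse = (λ a → ≈-trans (≋⇒≈ (++-comm (⊖ a) a)) (⊖-inverseʳ a)) , ⊖-inverseʳ
            ; ⁻¹-cong = ⊖-cong }
          ; comm = λ a b → ≋⇒≈ (++-comm a b) }
        ; *-cong = ⊛-cong
        ; *-assoc = λ a b c → ≋⇒≈ (⊛-assoc a b c)
        ; *-identity = (λ a → ≋⇒≈ (⊛-identityˡ a)) , (λ a → ≋⇒≈ λ f → trans (⊛-comm a [ 0 ] f) (⊛-identityˡ a f))
        ; distrib = (λ a b c → ≋⇒≈ (⊛-distribˡ a b c)) , (λ a b c → ≋⇒≈ (⊛-distribʳ a b c)) }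
      ; *-comm = λ a b → ≋⇒≈ (⊛-comm a b) } }

  open RingProperties groupRing using (_^_; 0^[p^j]≈0; frobenius^-+) renaming (_×_ to _·_)

  coefficient-% : ∀ a r → coefficient a (r % n) ≡ coefficient a r
  coefficient-% a r = ∑-cong a λ i → cong isZero (begin
    (i + r % n) % n             ≡⟨ %-distribˡ-+ i (r % n) n ⟩
    (i % n + r % n % n) % n     ≡⟨ cong (λ m → (i % n + m) % n) (m%n%n≡m%n r n) ⟩
    (i % n + r % n) % n         ≡⟨ %-distribˡ-+ i r n ⟨
    (i + r) % n                 ∎)
    where open ≡.≡-Reasoning

  _≟_ : Decidable _≈_
  a ≟ b = map′ extend (λ eq r → eq .at (toℕ r))
    (all? {n = n} λ r → coefficient a (toℕ r) % p ℕ.≟ coefficient b (toℕ r) % p)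
    where
    import Data.Nat.Properties as ℕ using (_≟_)
    extend : (∀ (r : Fin n) → coefficient a (toℕ r) % p ≡ coefficient b (toℕ r) % p) → a ≈ b
    extend eq .at r = subst (λ u → u % p ≡ coefficient b r % p) (coefficient-% a r)
      (subst (λ u → coefficient a (r % n) % p ≡ u % p) (coefficient-% b r)
        (subst (λ s → coefficient a s % p ≡ coefficient b s % p) (toℕ-fromℕ< (m%n<n r n)) (eq (fromℕ< (m%n<n r n)))))

  X^-cong : ∀ {i j} → i % n ≡ j % n → [ i ] ≈ [ j ]
  X^-cong {i} {j} eq .at r = cong (λ m → (m + 0) % p) (cong isZero (begin
    (i + r) % n               ≡⟨ %-distribˡ-+ i r n ⟩
    (i % n + r % n) % n       ≡⟨ cong (λ m → (m + r % n) % n) eq ⟩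
    (j % n + r % n) % n       ≡⟨ %-distribˡ-+ j r n ⟨
    (j + r) % n               ∎))
    where open ≡.≡-Reasoning

  X^-power : ∀ i m → [ i ] ^ m ≡ [ m * i ]
  X^-power i zero    = refl
  X^-power i (suc m) = cong ([ i ] ⊛_) (X^-power i m)

  ·1 : ∀ m → m · [ 0 ] ≡ concat (replicate m [ 0 ])
  ·1 zero    = refl
  ·1 (suc m) = cong (0 ∷_) (·1 m)

  p·1≈0 : p · [ 0 ] ≈ []
  p·1≈0 = subst (_≈ []) (sym (·1 p)) (copies≈0 [ 0 ])

  module _ (pr : Prime p) where

    x^q≈x : ∀ e → suc n ≡ p ℕ.^ e → ∀ a → a ^ (p ℕ.^ e) ≈ a
    x^q≈x e q []      = 0^[p^j]≈0 pr p·1≈0 e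
    x^q≈x e q (i ∷ a) = ≈-trans (frobenius^-+ pr p·1≈0 e [ i ] a) (++-cong X^ (x^q≈x e q a))
      where
      X^ : [ i ] ^ (p ℕ.^ e) ≈ [ i ]
      X^ = subst (λ m → [ i ] ^ m ≈ [ i ]) q
        (subst (_≈ [ i ]) (sym (X^-power i (suc n)))
          (X^-cong (trans (cong (λ m → (i + m) % n) (ℕₚ.*-comm n i)) ([m+kn]%n≡m%n i i n))))

  elements : ℕ → List Element
  elements zero    = [ [] ]
  elements (suc m) = cartesianProductWith (λ c b → replicate c m ++ b) (upTo p) (elements m)

  []∈elements : ∀ m → [] ∈ elements m
  []∈elements zero    = here refl
  []∈elements (suc m) =
    ∈-cartesianProductWith⁺ (λ c b → replicate c m ++ b) (∈-upTo⁺ (ℕ.>-nonZero⁻¹ p)) ([]∈elements m)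

  elements-∷ : ∀ {m j b} → j < m → b ∈ elements m → ∃ λ b′ → b′ ∈ elements m × j ∷ b ≈ b′
  elements-∷ {suc m} {j} j<1+m b∈ with ∈-cartesianProductWith⁻ (λ c b → replicate c m ++ b) (upTo p) (elements m) b∈
  ... | c , b , c∈ , b∈ , refl with ℕₚ.m≤n⇒m<n∨m≡n (ℕ.s≤s⁻¹ j<1+m)
  ...   | inj₁ j<m with b′ , b′∈ , eq ← elements-∷ j<m b∈ =
    replicate c m ++ b′ , ∈-cartesianProductWith⁺ (λ c b → replicate c m ++ b) c∈ b′∈ ,
    ≈-trans (≋⇒≈ λ f → swap f) (++-cong (≈-refl {replicate c m}) eq)
    where
    swap : j ∷ replicate c m ++ b ≋ replicate c m ++ (j ∷ b)
    swap f = begin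
      f j + ∑ (replicate c m ++ b) f              ≡⟨ cong (f j +_) (∑-++ (replicate c m) b f) ⟩
      f j + (∑ (replicate c m) f + ∑ b f)         ≡⟨ x∙yz≈y∙xz (f j) (∑ (replicate c m) f) (∑ b f) ⟩
      ∑ (replicate c m) f + (f j + ∑ b f)         ≡⟨ ∑-++ (replicate c m) (j ∷ b) f ⟨
      ∑ (replicate c m ++ (j ∷ b)) f              ∎
      where
      open ≡.≡-Reasoning
      open import Algebra.Properties.CommutativeSemigroup ℕₚ.+-commutativeSemigroup
        using (x∙yz≈y∙xz)
  ...   | inj₂ refl with ℕₚ.m≤n⇒m<n∨m≡n (∈-upTo⁻ c∈)
  ...     | inj₁ 1+c<p =
    m ∷ replicate c m ++ b , ∈-cartesianProductWith⁺ (λ c b → replicate c m ++ b) (∈-upTo⁺ 1+c<p) b∈ , ≈-refl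
  ...     | inj₂ refl =
    b , ∈-cartesianProductWith⁺ (λ c b → replicate c m ++ b) (∈-upTo⁺ (ℕ.>-nonZero⁻¹ p)) b∈ ,
    ++-cong {replicate (suc c) m} (subst (_≈ []) (concat-singletons (suc c) m) (copies≈0 [ m ])) (≈-refl {b})
    where
    concat-singletons : ∀ c (m : ℕ) → concat (replicate c [ m ]) ≡ replicate c m
    concat-singletons zero    m = refl
    concat-singletons (suc c) m = cong (m ∷_) (concat-singletons c m)

  normalise : ∀ a → ∃ λ b → b ∈ elements n × a ≈ b
  normalise []      = [] , []∈elements n , ≈-refl
  normalise (i ∷ a) with b , b∈ , eq ← normalise a with b′ , b′∈ , eq′ ← elements-∷ (m%n<n i n) b∈ =
    b′ , b′∈ , ≈-trans (++-cong (X^-cong (sym (m%n%n≡m%n i n))) eq) eq′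

  ∈elements : ∀ a → Any (a ≈_) (elements n)
  ∈elements a with b , b∈ , eq ← normalise a = Any.map (λ { refl → eq }) b∈

  HasDegree : Element → ℕ → Set
  HasDegree a d = ∃ λ as → a ≈ d ∷ as × All (_< d) as

  degree<n⇒≉0 : 1 < p → ∀ {a d} → HasDegree a d → d < n → ¬ a ≈ []
  degree<n⇒≉0 1<p {a} {d} (as , eq , as<d) d<n a≈0 = contradiction (begin
    1                                 ≡⟨ m<n⇒m%n≡m 1<p ⟨
    1 % p                             ≡⟨ cong (_% p) (cong₂ _+_ leading (lower as<d)) ⟨
    coefficient (d ∷ as) (n ∸ d) % p  ≡⟨ eq .at (n ∸ d) ⟨
    coefficient a (n ∸ d) % p         ≡⟨ a≈0 .at (n ∸ d) ⟩
    0 % p                             ≡⟨ m<n⇒m%n≡m (ℕ.>-nonZero⁻¹ p) ⟩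
    0                                 ∎) λ ()
    where
    open ≡.≡-Reasoning
    leading : divisible (d + (n ∸ d)) ≡ 1
    leading = cong isZero (trans (cong (_% n) (ℕₚ.m+[n∸m]≡n (ℕₚ.<⇒≤ d<n))) (n%n≡0 n))
    isZero-pos : ∀ {m} → 0 < m → isZero m ≡ 0
    isZero-pos (s≤s _) = refl
    lower : ∀ {as} → All (_< d) as → coefficient as (n ∸ d) ≡ 0
    lower []                     = refl
    lower {i ∷ as} (i<d ∷ as<d) = cong₂ _+_
      (trans (cong isZero (m<n⇒m%n≡m i+n-d<n)) (isZero-pos (ℕₚ.<-≤-trans (ℕₚ.m<n⇒0<n∸m d<n) (ℕₚ.m≤n+m (n ∸ d) i))))
      (lower as<d)
      where
      i+n-d<n : i + (n ∸ d) < n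
      i+n-d<n = ℕₚ.<-≤-trans (ℕₚ.+-monoˡ-< (n ∸ d) i<d) (ℕₚ.≤-reflexive (ℕₚ.m+[n∸m]≡n (ℕₚ.<⇒≤ d<n)))

  copies-All : ∀ {P : ℕ → Set} m {a} → All P a → All P (concat (replicate m a))
  copies-All zero    ps = []
  copies-All (suc m) ps = All.++⁺ ps (copies-All m ps)

  degree-* : ∀ {a d} m → 1 < m → HasDegree a d → HasDegree (([ 1 ] ^ m ++ ⊖ [ 1 ]) ⊛ a) (m + d)
  degree-* {a} {d} m 1<m (as , eq , as<d) =
    map (m +_) as ++ ⊖ [ 1 ] ⊛ (d ∷ as) ,
    ⊛-cong (++-cong (subst (_≈ [ m ]) (sym (trans (X^-power 1 m) (cong [_] (ℕₚ.*-identityʳ m)))) ≈-refl) (≈-refl {⊖ [ 1 ]})) eq ,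
    All.++⁺ (All.map⁺ (All.map (ℕₚ.+-monoʳ-< m) as<d))
      (All.tabulate λ i∈ → small (∈-cartesianProductWith⁻ _+_ (⊖ [ 1 ]) (d ∷ as) i∈))
    where
    small : ∀ {i} → (∃ λ j → ∃ λ l → j ∈ ⊖ [ 1 ] × l ∈ d ∷ as × i ≡ j + l) → i < m + d
    small (j , l , j∈ , l∈ , refl) = ℕₚ.+-mono-<-≤
      (subst (_< m) (sym (All.lookup (copies-All {_≡ 1} (ℕ.pred p) (refl ∷ [])) j∈)) 1<m)
      (All.lookup (ℕₚ.≤-refl ∷ All.map ℕₚ.<⇒≤ as<d) l∈)

  open Construction groupRing

  degree-conjugateDifferences : 1 < p → ∀ k →
    ∃ λ d → HasDegree (conjugateDifferences [ 1 ] p k) d × suc d < p ℕ.^ suc k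
  degree-conjugateDifferences 1<p zero    =
    0 , ([] , ≈-refl , []) , subst (1 <_) (sym (ℕₚ.*-identityʳ p)) 1<p
  degree-conjugateDifferences 1<p (suc k) with d , degree , 1+d<p^ ← degree-conjugateDifferences 1<p k =
    m + d , degree-* m (ℕₚ.≤-<-trans (s≤s z≤n) 1+d<p^) degree , (begin-strict
      suc (m + d)    ≡⟨ ℕₚ.+-suc m d ⟨
      m + suc d      <⟨ ℕₚ.+-monoʳ-< m 1+d<p^ ⟩
      m + m          ≡⟨ cong (m +_) (ℕₚ.+-identityʳ m) ⟨
      2 * m          ≤⟨ ℕₚ.*-monoˡ-≤ m 1<p ⟩
      p * m          ∎)
    where
    open ℕₚ.≤-Reasoning
    m = p ℕ.^ suc k

primePower⇒linearTernary : ∀ {p} → Prime p → ∀ e → LinearTernary (p ℕ.^ suc e)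
primePower⇒linearTernary {p} pr e =
  linearTernary {p} {e} pr p·1≈0 (ℕₚ.≤-trans 1<p (ℕₚ.m≤m*n p (p ℕ.^ e))) _≟_ (x^q≈x pr (suc e) suc-n≡q)
    (elements n) ∈elements [ 1 ] (degree<n⇒≉0 1<p degree (ℕ.s<s⁻¹ (subst (suc d <_) (sym suc-n≡q) 1+d<q)))
  where
  instance
    _ = prime⇒nonZero pr
    p^e≢0 = ℕₚ.m^n≢0 p e
    q≢0 = ℕₚ.m^n≢0 p (suc e)
  n = ℕ.pred (p ℕ.^ suc e)
  1<p : 1 < p
  1<p = ℕ.nonTrivial⇒n>1 p {{prime⇒nonTrivial pr}}
  1<q : 1 < p ℕ.^ suc e
  1<q = ℕₚ.≤-trans 1<p (ℕₚ.m≤m*n p (p ℕ.^ e))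
  suc-n≡q : suc n ≡ p ℕ.^ suc e
  suc-n≡q = ℕₚ.suc-pred (p ℕ.^ suc e)
  instance
    n≢0 : NonZero n
    n≢0 = ℕ.>-nonZero (ℕ.s<s⁻¹ (subst (1 <_) (sym suc-n≡q) 1<q))
  open GroupRing p n
  open Construction groupRing
  d = proj₁ (degree-conjugateDifferences 1<p e)
  degree = proj₁ (proj₂ (degree-conjugateDifferences 1<p e))
  1+d<q = proj₂ (proj₂ (degree-conjugateDifferences 1<p e))

-- The projective plane

open import Data.Fin.Properties using (_≟_)

private variable
  n : ℕ

∑-↭ : ∀ {xs ys : List A} → xs ↭ ys → ∀ f → ∑ xs f ≡ ∑ ys f
∑-↭ xs↭ys f = sum-↭ (map⁺ f xs↭ys)

χ : Bool → ℕ
χ true  = 1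
χ false = 0

χ-true : {P : Set} (P? : Dec P) → P → χ (does P?) ≡ 1
χ-true P? p = cong χ (dec-true P? p)

χ-false : {P : Set} (P? : Dec P) → ¬ P → χ (does P?) ≡ 0
χ-false P? ¬p = cong χ (dec-false P? ¬p)

χ⇒ : {P : Set} (P? : Dec P) → does P? ≡ true → P
χ⇒ (yes p) _ = p

∑-none : ∀ {xs} {f : A → ℕ} → All (λ x → f x ≡ 0) xs → ∑ xs f ≡ 0
∑-none []       = refl
∑-none (p ∷ ps) = cong₂ _+_ p (∑-none ps)

∑-single : ∀ {xs} (f : A → ℕ) {y} → Unique xs → y ∈ xs → f y ≡ 1 → (∀ x → x ≢ y → f x ≡ 0) → ∑ xs f ≡ 1
∑-single f (y∉xs ∷ _) (here refl) fy≡1 f≡0 = cong₂ _+_ fy≡1 (∑-none (All.map (λ y≢x → f≡0 _ (≢-sym y≢x)) y∉xs))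
∑-single f (x∉xs ∷ u) (there y∈)  fy≡1 f≡0 = cong₂ _+_ (f≡0 _ (All.lookup x∉xs y∈)) (∑-single f u y∈ fy≡1 f≡0)

∑-Fin-single : ∀ {k} (f : Fin k → ℕ) y → f y ≡ 1 → (∀ x → x ≢ y → f x ≡ 0) → ∑ (allFin k) f ≡ 1
∑-Fin-single {k} f y = ∑-single f (Unique.allFin⁺ k) (∈-allFin y)

extract : ∀ {ds xs : List A} → Unique ds → Unique xs → (∀ {d} → d ∈ ds → d ∈ xs) →
          ∃ λ rest → xs ↭ ds ++ rest × Unique rest
extract {xs = xs} [] uniq _ = xs , ↭-refl , uniq
extract {A = A} {ds = d ∷ ds} (d∉ds ∷ uniq-ds) uniq-xs ds⊆xs with ∈-∃++ (ds⊆xs (here refl))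
... | ys , zs , refl = rest , ↭-trans xs↭ (↭-prep d rest↭) , uniq-rest
  where
  xs↭ = shift d ys zs
  recursive : ∃ λ rest → ys ++ zs ↭ ds ++ rest × Unique rest
  recursive with d∉ ∷ uniq ← Permutation.Unique-resp-↭ (≡.setoid A) (↭⇒↭ₛ xs↭) uniq-xs =
    extract uniq-ds uniq λ {c} c∈ → case c∈ (∈-resp-↭ xs↭ (ds⊆xs (there c∈)))
    where
    case : ∀ {c} → c ∈ ds → c ∈ d ∷ ys ++ zs → c ∈ ys ++ zs
    case c∈ (here refl) = contradiction refl (All.lookup d∉ds c∈)
    case c∈ (there c∈′) = c∈′
  rest = proj₁ recursive
  rest↭ = proj₁ (proj₂ recursive)
  uniq-rest = proj₂ (proj₂ recursive)

toVec : ∀ {xs : List A} → length xs ≡ n → Unique xs → ∃ λ (v : Vec A n) → toList v ≡ xs × Vec.Unique v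
toVec {xs = xs} refl uniq = fromList xs , toList∘fromList xs , fromList-unique uniq
  where
  fromList-unique : ∀ {xs : List A} → Unique xs → Vec.Unique (fromList xs)
  fromList-unique []         = []
  fromList-unique (p ∷ uniq) = Vec.fromList⁺ p ∷ fromList-unique uniq

module IncidenceGraph {_I_ : A → B → Set} (_I?_ : ∀ a b → Dec (a I b))
  (linear : ∀ {P P′ ℓ ℓ′} → P I ℓ → P I ℓ′ → P′ I ℓ → P′ I ℓ′ → P ≡ P′ ⊎ ℓ ≡ ℓ′)
  (v : Vec A n) (w : Vec B n) (v-unique : Vec.Unique v) (w-unique : Vec.Unique w) where

  row : A → Vec Bool n
  row P = Vec.map (λ ℓ → does (P I? ℓ)) w

  graph : Subgraph n
  graph = Vec.map row v

  ∣row∣ : ∀ {m} P (w : Vec B m) → ∣ Vec.map (λ ℓ → does (P I? ℓ)) w ∣ ≡ ∑ (toList w) (λ ℓ → χ (does (P I? ℓ)))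
  ∣row∣ P []      = refl
  ∣row∣ P (ℓ ∷ w) with does (P I? ℓ)
  ... | true  = cong suc (∣row∣ P w)
  ... | false = ∣row∣ P w

  edges-graph : edges graph ≡ ∑ (toList v) (λ P → ∑ (toList w) (λ ℓ → χ (does (P I? ℓ))))
  edges-graph = go v
    where
    go : ∀ {m} (v : Vec A m) → Vec.sum (Vec.map ∣_∣ (Vec.map row v)) ≡ ∑ (toList v) (λ P → ∑ (toList w) (λ ℓ → χ (does (P I? ℓ))))
    go []      = refl
    go (P ∷ v) = cong₂ _+_ (∣row∣ P w) (go v)

  incident : ∀ i j → j ∈ˢ lookup graph i → lookup v i I lookup w j
  incident i j j∈ = χ⇒ (lookup v i I? lookup w j) (trans (sym (lookup-map j _ w))
    (trans (cong (λ r → lookup r j) (sym (lookup-map i row v))) ([]=⇒lookup j∈)))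

  linear-graph : ∀ {i i′ j j′} → i ≢ i′ → j ≢ j′ → j ∈ˢ lookup graph i → j′ ∈ˢ lookup graph i →
                 ¬ (j ∈ˢ lookup graph i′ × j′ ∈ˢ lookup graph i′)
  linear-graph {i} {i′} {j} {j′} i≢i′ j≢j′ a b (c , d)
    with linear (incident i j a) (incident i j′ b) (incident i′ j c) (incident i′ j′ d)
  ... | inj₁ eq = i≢i′ (Vec.lookup-injective v-unique i i′ eq)
  ... | inj₂ eq = j≢j′ (Vec.lookup-injective w-unique j j′ eq)

  graph-C₄-free : C₄-free graph
  graph-C₄-free (inj₁ i , inj₂ j , inj₁ i′ , inj₂ j′ , i≢i′ , j≢j′ , a , b , c , d) =
    linear-graph (i≢i′ ∘ cong inj₁) (j≢j′ ∘ cong inj₂) a d (b , c)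
  graph-C₄-free (inj₂ j , inj₁ i , inj₂ j′ , inj₁ i′ , j≢j′ , i≢i′ , a , b , c , d) =
    linear-graph (i≢i′ ∘ cong inj₁) (j≢j′ ∘ cong inj₂) a b (d , c)

module Plane {k : ℕ} (T : LinearTernary k) where
  open LinearTernary T

  -- Both the points and the lines of the plane: the point at infinity on the
  -- vertical lines, the points at infinity by slope, and the affine points;
  -- the line at infinity, the vertical lines, and the lines m x + y = b.
  data Flat : Set where
    ∞    : Flat
    mid  : Fin k → Flat
    pair : Fin k → Fin k → Flat

  infix 4 _I_ _I?_

  data _I_ : Flat → Flat → Set where
    ∞-∞       : ∞ I ∞
    ∞-mid     : ∀ {x} → ∞ I mid x
    mid-∞     : ∀ {m} → mid m I ∞
    mid-pair  : ∀ {m b} → mid m I pair m b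
    pair-mid  : ∀ {x y} → pair x y I mid x
    pair-pair : ∀ {x y m b} → intercept m x y ≡ b → pair x y I pair m b

  _I?_ : ∀ P ℓ → Dec (P I ℓ)
  ∞        I? ∞        = yes ∞-∞
  ∞        I? mid x    = yes ∞-mid
  ∞        I? pair m b = no λ ()
  mid m    I? ∞        = yes mid-∞
  mid m    I? mid x    = no λ ()
  mid m    I? pair n b = map′ (λ { refl → mid-pair }) (λ { mid-pair → refl }) (m ≟ n)
  pair x y I? ∞        = no λ ()
  pair x y I? mid z    = map′ (λ { refl → pair-mid }) (λ { pair-mid → refl }) (x ≟ z)
  pair x y I? pair m b = map′ pair-pair (λ { (pair-pair eq) → eq }) (intercept m x y ≟ b)

  linear : ∀ {P P′ ℓ ℓ′} → P I ℓ → P I ℓ′ → P′ I ℓ → P′ I ℓ′ → P ≡ P′ ⊎ ℓ ≡ ℓ′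
  linear ∞-∞            _              ∞-∞             _               = inj₁ refl
  linear ∞-∞            ∞-∞            mid-∞           _               = inj₂ refl
  linear ∞-mid          _              ∞-mid           _               = inj₁ refl
  linear ∞-mid          ∞-mid          pair-mid        pair-mid        = inj₂ refl
  linear mid-∞          _              ∞-∞             ∞-∞             = inj₂ refl
  linear mid-∞          mid-∞          mid-∞           _               = inj₂ refl
  linear mid-∞          mid-pair       mid-∞           mid-pair        = inj₁ refl
  linear mid-pair       _              mid-pair        _               = inj₁ refl
  linear mid-pair       mid-pair       (pair-pair eq)  (pair-pair eq′) = inj₂ (cong (pair _) (trans (sym eq) eq′))
  linear pair-mid       pair-mid       _               _               = inj₂ refl
  linear pair-mid       (pair-pair eq) pair-mid        (pair-pair eq′) = inj₁ (cong (pair _) (injective _ _ (trans eq (sym eq′))))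
  linear (pair-pair eq) (pair-pair eq′) mid-pair       mid-pair        = inj₂ (cong (pair _) (trans (sym eq) eq′))
  linear (pair-pair eq) pair-mid       (pair-pair eq′) pair-mid        = inj₁ (cong (pair _) (injective _ _ (trans eq (sym eq′))))
  linear (pair-pair p)  (pair-pair q)  (pair-pair r)   (pair-pair s) with independent (trans p (sym r)) (trans q (sym s))
  ... | inj₁ refl = inj₂ (cong (pair _) (trans (sym p) q))
  ... | inj₂ refl = inj₁ (cong (pair _) (injective _ _ (trans p (sym r))))

  incidence : Flat → Flat → ℕ
  incidence P ℓ = χ (does (P I? ℓ))

  F : List (Fin k)
  F = allFin k

  flats : List Flat
  flats = ∞ ∷ map mid F ++ cartesianProductWith pair F F

  ∈flats : ∀ P → P ∈ flats
  ∈flats ∞          = here refl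
  ∈flats (mid a)    = there (∈-++⁺ˡ (∈-map⁺ mid (∈-allFin a)))
  ∈flats (pair a b) = there (∈-++⁺ʳ (map mid F) (∈-cartesianProductWith⁺ pair (∈-allFin a) (∈-allFin b)))

  flats-unique : Unique flats
  flats-unique =
    All.tabulate (λ i∈ → λ { refl → ∞∉ (∈-++⁻ (map mid F) i∈) }) ∷
    Unique.++⁺ (Unique.map⁺ (λ { refl → refl }) (Unique.allFin⁺ k))
      (Unique.cartesianProductWith⁺ pair (λ { refl → refl , refl }) (Unique.allFin⁺ k) (Unique.allFin⁺ k))
      (λ (i∈ , j∈) → disjoint (∈-map⁻ mid i∈) (∈-cartesianProductWith⁻ pair F F j∈))
    where
    ∞∉ : ¬ (∞ ∈ map mid F ⊎ ∞ ∈ cartesianProductWith pair F F)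
    ∞∉ (inj₁ i∈) with () ← proj₂ (proj₂ (∈-map⁻ mid i∈))
    ∞∉ (inj₂ i∈) with _ , _ , _ , _ , () ← ∈-cartesianProductWith⁻ pair F F i∈
    disjoint : ∀ {P} → (∃ λ a → a ∈ F × P ≡ mid a) → ¬ (∃₂ λ a b → a ∈ F × b ∈ F × P ≡ pair a b)
    disjoint (_ , _ , refl) (_ , _ , _ , _ , ())

  ∑-flats : ∀ f → ∑ flats f ≡ f ∞ + (∑ F (f ∘ mid) + ∑ F (λ a → ∑ F (λ b → f (pair a b))))
  ∑-flats f = cong (f ∞ +_) (trans (∑-++ (map mid F) _ f)
    (cong₂ _+_ (∑-map mid F f) (∑-cartesianProductWith pair F F f)))

  ∑F-one : ∀ {f} → (∀ a → f a ≡ 1) → ∑ F f ≡ k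
  ∑F-one f≡1 = trans (∑-cong F f≡1) (trans (∑-const F 1) (trans (ℕₚ.*-identityʳ _) (List.length-tabulate id)))

  ∑F-zero : ∀ {f} → (∀ a → f a ≡ 0) → ∑ F f ≡ 0
  ∑F-zero f≡0 = trans (∑-cong F f≡0) (∑-zero F)

  ∑F-≡ˡ : ∀ a → ∑ F (λ b → χ (does (a ≟ b))) ≡ 1
  ∑F-≡ˡ a = ∑-Fin-single _ a (χ-true (a ≟ a) refl) (λ b b≢a → χ-false (a ≟ b) (≢-sym b≢a))

  ∑F-≡ʳ : ∀ b → ∑ F (λ a → χ (does (a ≟ b))) ≡ 1
  ∑F-≡ʳ b = ∑-Fin-single _ b (χ-true (b ≟ b) refl) (λ a a≢b → χ-false (a ≟ b) a≢b)

  ∑F-intercept : ∀ m x b → ∑ F (λ y → χ (does (intercept m x y ≟ b))) ≡ 1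
  ∑F-intercept m x b with y , eq ← surjective m x b =
    ∑-Fin-single _ y (χ-true (intercept m x y ≟ b) eq)
      (λ y′ y′≢y → χ-false (intercept m x y′ ≟ b) (λ eq′ → y′≢y (injective m x (trans eq′ (sym eq)))))

  point-degree : ∀ P → ∑ flats (incidence P) ≡ suc k
  point-degree ∞ = trans (∑-flats (incidence ∞)) (cong suc
    (trans (cong₂ _+_ (∑F-one λ _ → refl) (∑F-zero λ _ → ∑F-zero λ _ → refl)) (ℕₚ.+-identityʳ k)))
  point-degree (mid m) = trans (∑-flats (incidence (mid m))) (cong suc (cong₂ _+_ (∑F-zero λ _ → refl)
    (trans (∑-swap F F λ n b → χ (does (m ≟ n))) (∑F-one λ b → ∑F-≡ˡ m))))
  point-degree (pair x y) = trans (∑-flats (incidence (pair x y)))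
    (cong₂ _+_ (∑F-≡ˡ x) (∑F-one λ m → ∑F-≡ˡ (intercept m x y)))

  line-degree : ∀ ℓ → ∑ flats (λ P → incidence P ℓ) ≡ suc k
  line-degree ∞ = trans (∑-flats λ P → incidence P ∞) (cong suc
    (trans (cong₂ _+_ (∑F-one λ _ → refl) (∑F-zero λ _ → ∑F-zero λ _ → refl)) (ℕₚ.+-identityʳ k)))
  line-degree (mid z) = trans (∑-flats λ P → incidence P (mid z)) (cong suc (cong₂ _+_ (∑F-zero λ _ → refl)
    (trans (∑-swap F F λ x y → χ (does (x ≟ z))) (∑F-one λ y → ∑F-≡ʳ z))))
  line-degree (pair m b) = trans (∑-flats λ P → incidence P (pair m b))
    (cong₂ _+_ (∑F-≡ʳ m) (∑F-one λ x → ∑F-intercept m x b))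

  length-flats : length flats ≡ k ℕ.^ 2 + k + 1
  length-flats = begin
    length flats                                  ≡⟨ ℕₚ.*-identityʳ _ ⟨
    length flats * 1                              ≡⟨ ∑-const flats 1 ⟨
    ∑ flats (λ _ → 1)                             ≡⟨ ∑-flats (λ _ → 1) ⟩
    1 + (∑ F (λ _ → 1) + ∑ F (λ _ → ∑ F (λ _ → 1)))
      ≡⟨ cong (λ s → 1 + (s + ∑ F (λ _ → s))) (∑F-one λ _ → refl) ⟩
    1 + (k + ∑ F (λ _ → k))
      ≡⟨ cong (λ s → 1 + (k + s)) (trans (∑-const F k) (cong (_* k) (List.length-tabulate {n = k} id))) ⟩
    1 + (k + k * k)
      ≡⟨ solve 1 (λ k → con 1 :+ (k :+ k :* k) := k :^ 2 :+ k :+ con 1) refl k ⟩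
    k ℕ.^ 2 + k + 1                               ∎
    where
    open ≡.≡-Reasoning
    open import Data.Nat.Solver using (module +-*-Solver)
    open +-*-Solver using (solve; _:+_; _:*_; _:^_; con; _:=_)

  ∑∑ : List Flat → List Flat → ℕ
  ∑∑ Ps ℓs = ∑ Ps λ P → ∑ ℓs λ ℓ → incidence P ℓ

  -- Inclusion-exclusion, arranged so that no subtraction occurs.
  delete-count : ∀ {D E S T} → flats ↭ D ++ S → flats ↭ E ++ T →
                 ∑∑ S T + (length D + length E) * suc k ≡ (k ℕ.^ 2 + k + 1) * suc k + ∑∑ D E
  delete-count {D} {E} {S} {T} flats↭DS flats↭ET = begin
    ∑∑ S T + (length D + length E) * suc k
      ≡⟨ cong (∑∑ S T +_) (ℕₚ.*-distribʳ-+ (suc k) (length D) (length E)) ⟩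
    ∑∑ S T + (length D * suc k + length E * suc k) ≡⟨ cong (λ s → ∑∑ S T + (length D * suc k + s)) lines ⟨
    ∑∑ S T + (length D * suc k + (∑∑ D E + ∑∑ S E))
      ≡⟨ solve 4 (λ st d de se → st :+ (d :+ (de :+ se)) := d :+ (se :+ st) :+ de) refl (∑∑ S T) (length D * suc k) (∑∑ D E) (∑∑ S E) ⟩
    length D * suc k + (∑∑ S E + ∑∑ S T) + ∑∑ D E ≡⟨ cong (λ s → length D * suc k + s + ∑∑ D E) split-lines ⟨
    length D * suc k + length S * suc k + ∑∑ D E
      ≡⟨ cong (_+ ∑∑ D E) (ℕₚ.*-distribʳ-+ (suc k) (length D) (length S)) ⟨
    (length D + length S) * suc k + ∑∑ D E        ≡⟨ cong (λ l → l * suc k + ∑∑ D E) total ⟩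
    (k ℕ.^ 2 + k + 1) * suc k + ∑∑ D E            ∎
    where
    open ≡.≡-Reasoning
    open import Data.Nat.Solver using (module +-*-Solver)
    open +-*-Solver using (solve; _:+_; _:=_)
    points : ∀ Ps → ∑∑ Ps flats ≡ length Ps * suc k
    points Ps = trans (∑-cong Ps point-degree) (∑-const Ps (suc k))
    total : length D + length S ≡ k ℕ.^ 2 + k + 1
    total = trans (sym (List.length-++ D)) (trans (sym (↭-length flats↭DS)) length-flats)
    split-lines : length S * suc k ≡ ∑∑ S E + ∑∑ S T
    split-lines = trans (sym (points S)) (trans
      (∑-cong S λ P → trans (∑-↭ flats↭ET (incidence P)) (∑-++ E T (incidence P))) (∑-+ S _ _))
    lines : ∑∑ D E + ∑∑ S E ≡ length E * suc k
    lines = begin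
      ∑∑ D E + ∑∑ S E                         ≡⟨ ∑-++ D S _ ⟨
      ∑∑ (D ++ S) E                           ≡⟨ ∑-↭ flats↭DS _ ⟨
      ∑∑ flats E                              ≡⟨ ∑-swap flats E incidence ⟩
      ∑ E (λ ℓ → ∑ flats (λ P → incidence P ℓ)) ≡⟨ ∑-cong E line-degree ⟩
      ∑ E (λ _ → suc k)                       ≡⟨ ∑-const E (suc k) ⟩
      length E * suc k                        ∎

  remaining : ∀ {h} (D : List Flat) {S} → flats ↭ D ++ S → length D ≡ h → length S ≡ k ℕ.^ 2 + k + 1 ∸ h
  remaining D {S} flats↭DS refl = begin
    length S                          ≡⟨ ℕₚ.m+n∸m≡n (length D) (length S) ⟨
    length D + length S ∸ length D    ≡⟨ cong (_∸ length D) (List.length-++ D) ⟨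
    length (D ++ S) ∸ length D        ≡⟨ cong (_∸ length D) (↭-length flats↭DS) ⟨
    length flats ∸ length D           ≡⟨ cong (_∸ length D) length-flats ⟩
    k ℕ.^ 2 + k + 1 ∸ length D        ∎
    where
    open ≡.≡-Reasoning

  deletion : ∀ {h} (D E : List Flat) → Unique D → Unique E → length D ≡ h → length E ≡ h →
             Σ[ G ∈ Subgraph (k ℕ.^ 2 + k + 1 ∸ h) ] C₄-free G ×
               edges G + (h + h) * suc k ≡ (k ℕ.^ 2 + k + 1) * suc k + ∑∑ D E
  deletion D E D-unique E-unique refl ∣E∣≡h
    with S , flats↭DS , S-unique ← extract D-unique flats-unique (λ {P} _ → ∈flats P)
       | T , flats↭ET , T-unique ← extract E-unique flats-unique (λ {P} _ → ∈flats P)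
    with v , refl , v-unique ← toVec (remaining D flats↭DS refl) S-unique
       | w , refl , w-unique ← toVec (remaining E flats↭ET ∣E∣≡h) T-unique =
    graph , graph-C₄-free , (begin
      edges graph + (h + h) * suc k                  ≡⟨ cong (_+ (h + h) * suc k) edges-graph ⟩
      ∑∑ (toList v) (toList w) + (h + h) * suc k
        ≡⟨ cong (λ l → ∑∑ (toList v) (toList w) + (h + l) * suc k) ∣E∣≡h ⟨
      ∑∑ (toList v) (toList w) + (h + length E) * suc k ≡⟨ delete-count {D} {E} flats↭DS flats↭ET ⟩
      (k ℕ.^ 2 + k + 1) * suc k + ∑∑ D E             ∎)
    where
    open ≡.≡-Reasoning
    h = length D
    open IncidenceGraph _I?_ linear v w v-unique w-unique

incidences : Fin 5 → ℕ
incidences 0F = 0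
incidences 1F = 1
incidences 2F = 3
incidences 3F = 6
incidences 4F = 9

module Deletion {k : ℕ} (T : LinearTernary (2 + k)) where
  open LinearTernary T
  open Plane T

  deleted-points deleted-lines : List Flat
  deleted-points = ∞ ∷ mid 0F ∷ pair 0F 0F ∷ mid 1F ∷ []
  deleted-lines  = ∞ ∷ mid 0F ∷ pair 0F (intercept 0F 0F 0F) ∷ pair 1F (intercept 1F 0F 0F) ∷ []

  deleted-points-unique : Unique deleted-points
  deleted-points-unique = ((λ ()) ∷ (λ ()) ∷ (λ ()) ∷ []) ∷ ((λ ()) ∷ (λ ()) ∷ []) ∷ ((λ ()) ∷ []) ∷ [] ∷ []

  deleted-lines-unique : Unique deleted-lines
  deleted-lines-unique = ((λ ()) ∷ (λ ()) ∷ (λ ()) ∷ []) ∷ ((λ ()) ∷ (λ ()) ∷ []) ∷ ((λ ()) ∷ []) ∷ [] ∷ []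

  ∑∑-deleted : ∀ h → ∑∑ (take (toℕ h) deleted-points) (take (toℕ h) deleted-lines) ≡ incidences h
  ∑∑-deleted 0F = refl
  ∑∑-deleted 1F = refl
  ∑∑-deleted 2F = refl
  ∑∑-deleted 3F rewrite dec-true (intercept 0F 0F 0F ≟ intercept 0F 0F 0F) refl = refl
  ∑∑-deleted 4F rewrite dec-true (intercept 0F 0F 0F ≟ intercept 0F 0F 0F) refl
                      | dec-true (intercept 1F 0F 0F ≟ intercept 1F 0F 0F) refl = refl

  length-prefix : ∀ (h : Fin 5) (xs : List Flat) → length xs ≡ 4 → length (take (toℕ h) xs) ≡ toℕ h
  length-prefix h xs eq = trans (List.length-take (toℕ h) xs)
    (ℕₚ.m≤n⇒m⊓n≡m (subst (toℕ h ≤_) (sym eq) (toℕ≤pred[n] h)))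

  graph-with-edges : (h : Fin 5) → let K = 2 + k in
    Σ[ G ∈ Subgraph (K ℕ.^ 2 + K + 1 ∸ toℕ h) ] C₄-free G ×
      edges G + (toℕ h + toℕ h) * suc K ≡ (K ℕ.^ 2 + K + 1) * suc K + incidences h
  graph-with-edges h
    with G , free , eq ← deletion (take (toℕ h) deleted-points) (take (toℕ h) deleted-lines)
           (Unique.take⁺ (toℕ h) deleted-points-unique) (Unique.take⁺ (toℕ h) deleted-lines-unique)
           (length-prefix h deleted-points refl) (length-prefix h deleted-lines refl) =
    G , free , trans eq (cong ((K ℕ.^ 2 + K + 1) * suc K +_) (∑∑-deleted h))
    where K = 2 + k

open import Data.Integer.Base as ℤ using (+_)
open import Data.Nat.Base using (_^_)
import Data.Integer.Properties as ℤₚ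
open import Data.Integer.Solver using (module +-*-Solver)

bound-unique : ∀ {k c e} m (b : ℤ.ℤ) → e + m ℕ.* suc k ≡ (k ^ 2 + k + 1) ℕ.* suc k + c →
  ((+ k) ℤ.^ 2 ℤ.+ + k ℤ.+ + 1) ℤ.* (+ 1 ℤ.+ + k) ℤ.+ + c ≡ b ℤ.+ + m ℤ.* (+ 1 ℤ.+ + k) → + e ≡ b
bound-unique {k} {c} {e} m b count identity = ∙-cancelʳ (+ m ℤ.* + suc k) (+ e) b (begin
  + e ℤ.+ + m ℤ.* + suc k                                 ≡⟨ cong (λ t → + e ℤ.+ t) (ℤₚ.pos-* m (suc k)) ⟨
  + (e + m ℕ.* suc k)                                     ≡⟨ cong +_ count ⟩
  + ((k ^ 2 + k + 1) ℕ.* suc k) ℤ.+ + c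
    ≡⟨ cong (ℤ._+ + c) (ℤₚ.pos-* (k ^ 2 + k + 1) (suc k)) ⟩
  (+ (k ^ 2) ℤ.+ + k ℤ.+ + 1) ℤ.* + suc k ℤ.+ + c
    ≡⟨ cong (λ t → (t ℤ.+ + k ℤ.+ + 1) ℤ.* + suc k ℤ.+ + c) square ⟩
  ((+ k) ℤ.^ 2 ℤ.+ + k ℤ.+ + 1) ℤ.* + suc k ℤ.+ + c         ≡⟨ identity ⟩
  b ℤ.+ + m ℤ.* + suc k                                   ∎)
  where
  open import Algebra.Properties.Group (AbelianGroup.group ℤₚ.+-0-abelianGroup) using (∙-cancelʳ)
  open ≡.≡-Reasoning
  square : + (k ^ 2) ≡ (+ k) ℤ.^ 2
  square = trans (ℤₚ.pos-* k (k ^ 1)) (cong (λ t → + k ℤ.* t) (ℤₚ.pos-* k 1))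

-- The bounds as functions of an integer variable, because ℤ's operations on + k reduce
-- and leave nothing for the ring solver to reify.
polynomialBound : Fin 5 → ℤ.ℤ → ℤ.ℤ
polynomialBound 0F x = x ℤ.^ 3 ℤ.+ + 2 ℤ.* x ℤ.^ 2 ℤ.+ + 2 ℤ.* x ℤ.+ + 1
polynomialBound 1F x = x ℤ.^ 3 ℤ.+ + 2 ℤ.* x ℤ.^ 2
polynomialBound 2F x = x ℤ.^ 3 ℤ.+ + 2 ℤ.* x ℤ.^ 2 ℤ.- + 2 ℤ.* x
polynomialBound 3F x = x ℤ.^ 3 ℤ.+ + 2 ℤ.* x ℤ.^ 2 ℤ.- + 4 ℤ.* x ℤ.+ + 1
polynomialBound 4F x = x ℤ.^ 3 ℤ.+ + 2 ℤ.* x ℤ.^ 2 ℤ.- + 6 ℤ.* x ℤ.+ + 2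

polynomialBound-identity : ∀ h x → (x ℤ.^ 2 ℤ.+ x ℤ.+ + 1) ℤ.* (+ 1 ℤ.+ x) ℤ.+ + incidences h ≡
                           polynomialBound h x ℤ.+ + (toℕ h + toℕ h) ℤ.* (+ 1 ℤ.+ x)
polynomialBound-identity 0F = solve 1 (λ x → (x :^ 2 :+ x :+ con (+ 1)) :* (con (+ 1) :+ x) :+ con (+ 0) :=
  x :^ 3 :+ con (+ 2) :* x :^ 2 :+ con (+ 2) :* x :+ con (+ 1) :+ con (+ 0) :* (con (+ 1) :+ x)) refl
  where open +-*-Solver
polynomialBound-identity 1F = solve 1 (λ x → (x :^ 2 :+ x :+ con (+ 1)) :* (con (+ 1) :+ x) :+ con (+ 1) :=
  x :^ 3 :+ con (+ 2) :* x :^ 2 :+ con (+ 2) :* (con (+ 1) :+ x)) refl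
  where open +-*-Solver
polynomialBound-identity 2F = solve 1 (λ x → (x :^ 2 :+ x :+ con (+ 1)) :* (con (+ 1) :+ x) :+ con (+ 3) :=
  x :^ 3 :+ con (+ 2) :* x :^ 2 :- con (+ 2) :* x :+ con (+ 4) :* (con (+ 1) :+ x)) refl
  where open +-*-Solver
polynomialBound-identity 3F = solve 1 (λ x → (x :^ 2 :+ x :+ con (+ 1)) :* (con (+ 1) :+ x) :+ con (+ 6) :=
  x :^ 3 :+ con (+ 2) :* x :^ 2 :- con (+ 4) :* x :+ con (+ 1) :+ con (+ 6) :* (con (+ 1) :+ x)) refl
  where open +-*-Solver
polynomialBound-identity 4F = solve 1 (λ x → (x :^ 2 :+ x :+ con (+ 1)) :* (con (+ 1) :+ x) :+ con (+ 9) :=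
  x :^ 3 :+ con (+ 2) :* x :^ 2 :- con (+ 6) :* x :+ con (+ 2) :+ con (+ 8) :* (con (+ 1) :+ x)) refl
  where open +-*-Solver

bound≡polynomialBound : ∀ k h → bound k h ≡ polynomialBound h (+ k)
bound≡polynomialBound k 0F = refl
bound≡polynomialBound k 1F = refl
bound≡polynomialBound k 2F = refl
bound≡polynomialBound k 3F = refl
bound≡polynomialBound k 4F = refl

attains-bound : ∀ {k n} h →
  (Σ[ G ∈ Subgraph n ] C₄-free G ×
    edges G + (toℕ h + toℕ h) ℕ.* suc k ≡ (k ^ 2 + k + 1) ℕ.* suc k + incidences h) →
  (Σ[ G ∈ Subgraph n ] C₄-free G × + edges G ≡ bound k h) × (bound k h ℤ.≤ + z n)
attains-bound {k} {n} h (G , free , count) =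
  (G , free , edges≡bound) , subst (ℤ._≤ + z n) edges≡bound (ℤ.+≤+ (edges≤z G free))
  where
  edges≡bound : + edges G ≡ bound k h
  edges≡bound = trans
    (bound-unique (toℕ h + toℕ h) (polynomialBound h (+ k)) count (polynomialBound-identity h (+ k)))
    (sym (bound≡polynomialBound k h))

theorem2 : (k : ℕ) → IsPrimePower k → (h : Fin 5) →
    let n = k ^ 2 + k + 1 ∸ toℕ h in
    (Σ[ G ∈ Subgraph n ] C₄-free G × + edges G ≡ bound k h)
    × (bound k h ℤ.≤ + z n)
theorem2 k (p , suc e , pr , _ , k≡q) h =
  attains-bound h (construct k≡q 2≤q (primePower⇒linearTernary pr e))
  where
  2≤q : 2 ≤ p ^ suc e
  2≤q = ℕₚ.≤-trans (ℕ.nonTrivial⇒n>1 p {{prime⇒nonTrivial pr}})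
    (ℕₚ.m≤m*n p (p ^ e) {{ℕₚ.m^n≢0 p e {{prime⇒nonZero pr}}}})
  construct : ∀ {k q} → k ≡ q → 2 ≤ q → LinearTernary q →
    Σ[ G ∈ Subgraph (k ^ 2 + k + 1 ∸ toℕ h) ] C₄-free G ×
      edges G + (toℕ h + toℕ h) ℕ.* suc k ≡ (k ^ 2 + k + 1) ℕ.* suc k + incidences h
  construct refl (s≤s (s≤s z≤n)) T = Deletion.graph-with-edges T h
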